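{- Let $G$ be a finite connected simple graph with $n$ vertices and $m$ edges, and let $a,b\in\mathbb{C}$, $c=a-b$. Let $\mathbf d:\ell^2(R(G))\to\ell^2(V(G))$ be a linear map with $\mathbf d\mathbf d^*=\mathbf I_n$, put $\mathbf C=a\,\mathbf d^*\mathbf d+b(\mathbf I_{2m}-\mathbf d^*\mathbf d)$ and $\mathbf U=\mathbf S\mathbf C$. Then for every $u\in\mathbb{C}$ with $b^2u^2\neq 1$, \[ \det(\mathbf I_{2m}-u\mathbf U)=(1-b^2u^2)^{m-n}\det\big((1-abu^2)\mathbf I_n-cu\,\mathbf d\mathbf S\mathbf d^*\big). \] Equivalently, the zeta function $\zeta(G,u)=\det(\mathbf I_{2m}-u\mathbf U)^{ -1}$ satisfies $\zeta(G,u)^{ -1}=(1-b^2u^2)^{m-n}\det((1-abu^2)\mathbf I_n-cu\,\mathbf d\mathbf S\mathbf d^*)$.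
   Context: For a simple graph $G$, $R(G)=\{(u,v),(v,u): uv\in E(G)\}$ is the set of arcs (so $|R(G)|=2m$); for $e=(u,v)$, $e^{ -1}=(v,u)$. $\ell^2(V(G))\cong\mathbb{C}^n$ and $\ell^2(R(G))\cong\mathbb{C}^{2m}$ are the spaces of complex functions on vertices and arcs with the standard inner product; $\mathbf d^*$ denotes the adjoint of $\mathbf d$. $\mathbf S$ is the arc-reversal operator on $\ell^2(R(G))$: $(\mathbf S\omega)(e)=\omega(e^{ -1})$. $\mathbf I_k$ is the identity of size $k$. The matrix $\mathbf U=\mathbf S\mathbf C$ is the time evolution matrix of a "general coined quantum walk" on $G$. -}

module Defs where

open import Algebra.Apartness.Bundles using (HeytingField)
open import Algebra.Bundles using (CommutativeRing)
open import Algebra.Consequences.Setoid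
  using (comm∧idˡ⇒id; comm∧invˡ⇒inv; comm∧distrʳ⇒distr)
open import Algebra.Module.Bundles using (LeftModule)
open import Algebra.Module.Morphism.Structures using (module LeftModuleMorphisms)
import Algebra.Apartness.Properties.HeytingCommutativeRing as HeytingProperties
import Algebra.Construct.Pointwise as Pointwise
import Algebra.Properties.CommutativeMonoid.Sum as CommutativeMonoidSum
import Algebra.Properties.Semiring.Exp as SemiringExp
import Algebra.Properties.Semiring.Sum as SemiringSum
open import Data.Bool.Base using (Bool; false; T; if_then_else_)
open import Data.Bool.Properties using (T-irrelevant)
open import Data.Empty using (⊥-elim)
open import Data.Fin.Base as Fin using (Fin; zero; suc; toℕ; punchIn)
import Data.Fin.Properties as Fin
open import Data.Integer.Base using (ℤ; +_; -[1+_])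
open import Data.Nat.Base as ℕ using (ℕ; zero; suc)
import Data.Nat.Properties as ℕ
open import Data.Product.Base using (Σ; Σ-syntax; ∃-syntax; _×_; _,_; proj₁; proj₂)
open import Data.Rational as ℚ using (ℚ; 0ℚ; 1ℚ; ∣_∣; _<_; _≤_; 1/_)
import Data.Rational.Properties as ℚ
open import Data.Rational.Solver using (module +-*-Solver)
open import Data.Sum.Base using (_⊎_; inj₁; inj₂)
open import Data.Sum.Function.Propositional using (_⊎-↔_)
open import Function.Base using (_∘_; id)
open import Function.Bundles using (_↔_; Inverse; mk↔ₛ′)
open import Function.Construct.Composition using (_↔-∘_)
open import Level using (0ℓ)
open import Relation.Binary.Construct.Closure.ReflexiveTransitive using (Star)
open import Relation.Binary.Bundles using (Setoid)
open import Relation.Binary.Core using (Rel)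
open import Relation.Binary.Definitions using (tri<; tri≈; tri>)
open import Relation.Binary.PropositionalEquality as ≡ using (_≡_; cong; cong₂; subst)
open import Relation.Binary.Structures using (IsEquivalence)
import Relation.Binary.Reasoning.Setoid as SetoidReasoning
open import Relation.Nullary using (¬_; does; yes; no)

private
  module RationalLemmas where

    open import Data.Rational using (_+_; _*_; _-_; -_)

    triangle : ∀ {p q α β} → ∣ p ∣ < α → ∣ q ∣ < β → ∣ p + q ∣ < α + β
    triangle {p} {q} p<α q<β =
      ℚ.≤-<-trans (ℚ.∣p+q∣≤∣p∣+∣q∣ p q) (ℚ.+-mono-< p<α q<β)

    product : ∀ {p q α β} → ∣ p ∣ < α → ∣ q ∣ < β → ∣ p * q ∣ < α * β
    product {p} {q} {α} {β} p<α q<β = subst (_< α * β) (≡.sym (ℚ.∣p*q∣≡∣p∣*∣q∣ p q))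
      (ℚ.≤-<-trans
        (ℚ.*-monoʳ-≤-nonNeg ∣ q ∣ {{ℚ.∣-∣-nonNeg q}} (ℚ.<⇒≤ p<α))
        (ℚ.*-monoʳ-<-pos α {{ℚ.positive (ℚ.≤-<-trans (ℚ.0≤∣p∣ p) p<α)}} q<β))

    0<* : ∀ {p q} → 0ℚ < p → 0ℚ < q → 0ℚ < p * q
    0<* {p} {q} 0<p 0<q =
      subst (_< p * q) (ℚ.*-zeroʳ p) (ℚ.*-monoʳ-<-pos p {{ℚ.positive 0<p}} 0<q)

    0<+ : ∀ {p q} → 0ℚ < p → 0ℚ < q → 0ℚ < p + q
    0<+ = ℚ.+-mono-<

    reciprocal : ∀ K → 0ℚ < K → Σ[ L ∈ ℚ ] 0ℚ < L × K * L ≡ 1ℚ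
    reciprocal K 0<K =
      L , ℚ.positive⁻¹ L {{ℚ.1/pos⇒pos K {{K-pos}}}} , ℚ.*-inverseʳ K {{K-nz}}
      where
      K-pos : ℚ.Positive K
      K-pos = ℚ.positive 0<K
      K-nz : ℚ.NonZero K
      K-nz = ℚ.pos⇒nonZero K {{K-pos}}
      L : ℚ
      L = (1/ K) {{K-nz}}

    rescale : ∀ (P : ℚ → Set) K → 0ℚ < K → (∀ ε → 0ℚ < ε → P (K * ε)) →
              ∀ ε → 0ℚ < ε → P ε
    rescale P K 0<K h ε 0<ε with L , 0<L , KL≡1 ← reciprocal K 0<K =
      subst P
        (≡.trans (≡.sym (ℚ.*-assoc K L ε)) (≡.trans (cong (_* ε) KL≡1) (ℚ.*-identityˡ ε)))
        (h (L * ε) (0<* 0<L 0<ε))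

    0<1 : 0ℚ < 1ℚ
    0<1 = ℚ.positive⁻¹ 1ℚ

    halve : ∀ (P : ℚ → Set) → (∀ ε → 0ℚ < ε → P (ε + ε)) → ∀ ε → 0ℚ < ε → P ε
    halve P h = rescale P (1ℚ + 1ℚ) (0<+ 0<1 0<1) λ ε 0<ε → subst P (eq ε) (h ε 0<ε)
      where
      eq : ∀ ε → ε + ε ≡ (1ℚ + 1ℚ) * ε
      eq = solve 1 (λ e → e :+ e := (con 1ℚ :+ con 1ℚ) :* e) ≡.refl
        where open +-*-Solver

    ∣p-q∣≡∣q-p∣ : ∀ p q → ∣ p - q ∣ ≡ ∣ q - p ∣
    ∣p-q∣≡∣q-p∣ p q = ≡.trans (≡.sym (ℚ.∣-p∣≡∣p∣ (p - q))) (cong ∣_∣ (eq p q))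
      where
      eq : ∀ p q → - (p - q) ≡ q - p
      eq = solve 2 (λ p q → :- (p :+ :- q) := q :+ :- p) ≡.refl
        where open +-*-Solver

    ∣p-p∣<ε : ∀ p {ε} → 0ℚ < ε → ∣ p - p ∣ < ε
    ∣p-p∣<ε p {ε} = subst (_< ε) (cong ∣_∣ (≡.sym (ℚ.+-inverseʳ p)))

    product-difference : ∀ p q r s → p * q - r * s ≡ (p - r) * q + r * (q - s)
    product-difference =
      solve 4 (λ p q r s → p :* q :+ :- (r :* s) := (p :+ :- r) :* q :+ r :* (q :+ :- s)) ≡.refl
      where open +-*-Solver

    -- Pseudo-inverse, with value 0 at 0.
    inv : ℚ → ℚ
    inv q with q ℚ.≟ 0ℚ
    ... | yes _  = 0ℚ
    ... | no q≢0 = (1/ q) {{ℚ.≢-nonZero q≢0}}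

    inv-inverse : ∀ q {ε} → 0ℚ < ε → ε < ∣ q ∣ → q * inv q ≡ 1ℚ
    inv-inverse q 0<ε ε<q with q ℚ.≟ 0ℚ
    ... | yes ≡.refl = ⊥-elim (ℚ.<-asym 0<ε ε<q)
    ... | no q≢0     = ℚ.*-inverseʳ q {{ℚ.≢-nonZero q≢0}}

    inv-bound : ∀ q {ε L} → 0ℚ < ε → ε < ∣ q ∣ → ε * L ≡ 1ℚ → ∣ inv q ∣ < L + 1ℚ
    inv-bound q {ε} {L} 0<ε ε<q εL≡1 = ℚ.≤-<-trans
      (ℚ.*-cancelˡ-≤-pos ε {{ℚ.positive 0<ε}} (subst (ε * ∣ inv q ∣ ≤_) eq
        (ℚ.*-monoʳ-≤-nonNeg ∣ inv q ∣ {{ℚ.∣-∣-nonNeg (inv q)}} (ℚ.<⇒≤ ε<q))))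
      (subst (_< L + 1ℚ) (ℚ.+-identityʳ L) (ℚ.+-monoʳ-< L 0<1))
      where
      eq : ∣ q ∣ * ∣ inv q ∣ ≡ ε * L
      eq = ≡.trans (≡.sym (ℚ.∣p*q∣≡∣p∣*∣q∣ q (inv q)))
             (≡.trans (cong ∣_∣ (inv-inverse q 0<ε ε<q)) (≡.sym εL≡1))

open RationalLemmas

------------------------------------------------------------------------
-- The real numbers

Cauchy : (ℕ → ℚ) → Set
Cauchy x = ∀ ε → 0ℚ < ε →
  ∃[ N ] (∀ i j → N ℕ.≤ i → N ℕ.≤ j → ∣ x i ℚ.- x j ∣ < ε)

record ℝ : Set where
  constructor mkℝ
  field
    seq    : ℕ → ℚ
    cauchy : Cauchy seq
open ℝ public

infix 4 _≈ℝ_ _#ℝ_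

_≈ℝ_ : Rel ℝ 0ℓ
x ≈ℝ y = ∀ ε → 0ℚ < ε → ∃[ N ] (∀ i → N ℕ.≤ i → ∣ seq x i ℚ.- seq y i ∣ < ε)

-- The constructively positive form of inequality.
_#ℝ_ : Rel ℝ 0ℓ
x #ℝ y = ∃[ ε ] (0ℚ < ε × ∃[ N ] (∀ i → N ℕ.≤ i → ε < ∣ seq x i ℚ.- seq y i ∣))

private
  max₁ : ∀ {i} M N → M ℕ.⊔ N ℕ.≤ i → M ℕ.≤ i
  max₁ M N = ℕ.≤-trans (ℕ.m≤m⊔n M N)

  max₂ : ∀ {i} M N → M ℕ.⊔ N ℕ.≤ i → N ℕ.≤ i
  max₂ M N = ℕ.≤-trans (ℕ.m≤n⊔m M N)

  bounded : ∀ x → ∃[ B ] (0ℚ < B × ∃[ N ] (∀ i → N ℕ.≤ i → ∣ seq x i ∣ < B))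
  bounded x with N , h ← cauchy x 1ℚ 0<1 =
    ∣ seq x N ∣ ℚ.+ 1ℚ ,
    ℚ.+-mono-≤-< (ℚ.0≤∣p∣ (seq x N)) 0<1 ,
    N , λ i N≤i → ℚ.≤-<-trans
      (subst (λ p → ∣ p ∣ ≤ ∣ seq x N ∣ ℚ.+ ∣ seq x i ℚ.- seq x N ∣) (eq (seq x N) (seq x i))
        (ℚ.∣p+q∣≤∣p∣+∣q∣ (seq x N) (seq x i ℚ.- seq x N)))
      (ℚ.+-monoʳ-< ∣ seq x N ∣ (h i N N≤i ℕ.≤-refl))
    where
    eq : ∀ p q → p ℚ.+ (q ℚ.- p) ≡ q
    eq = solve 2 (λ p q → p :+ (q :+ :- p) := q) ≡.refl
      where open +-*-Solver

  sum-difference : ∀ p q r s → (p ℚ.+ q) ℚ.- (r ℚ.+ s) ≡ (p ℚ.- r) ℚ.+ (q ℚ.- s)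
  sum-difference =
    solve 4 (λ p q r s → (p :+ q) :+ :- (r :+ s) := (p :+ :- r) :+ (q :+ :- s)) ≡.refl
    where open +-*-Solver

  neg-difference : ∀ p q → ∣ p ℚ.- q ∣ ≡ ∣ (ℚ.- p) ℚ.- (ℚ.- q) ∣
  neg-difference p q = ≡.trans (≡.sym (ℚ.∣-p∣≡∣p∣ (p ℚ.- q))) (cong ∣_∣ (eq p q))
    where
    eq : ∀ p q → ℚ.- (p ℚ.- q) ≡ (ℚ.- p) ℚ.- (ℚ.- q)
    eq = solve 2 (λ p q → :- (p :+ :- q) := :- p :+ :- (:- q)) ≡.refl
      where open +-*-Solver

  close-* : ∀ {p q r s B C ε} → ∣ q ∣ < C → ∣ r ∣ < B → ∣ p ℚ.- r ∣ < ε → ∣ q ℚ.- s ∣ < ε →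
            ∣ p ℚ.* q ℚ.- r ℚ.* s ∣ < (C ℚ.+ B) ℚ.* ε
  close-* {p} {q} {r} {s} {B} {C} {ε} q<C r<B pr<ε qs<ε =
    ≡.subst₂ (λ t u → ∣ t ∣ < u) (≡.sym (product-difference p q r s)) (eq C B ε)
      (triangle {(p ℚ.- r) ℚ.* q} {r ℚ.* (q ℚ.- s)}
        (product {p ℚ.- r} {q} pr<ε q<C) (product {r} {q ℚ.- s} r<B qs<ε))
    where
    eq : ∀ C B ε → ε ℚ.* C ℚ.+ B ℚ.* ε ≡ (C ℚ.+ B) ℚ.* ε
    eq = solve 3 (λ C B e → e :* C :+ B :* e := (C :+ B) :* e) ≡.refl
      where open +-*-Solver

  opaque
    cauchy-const : ∀ q → Cauchy (λ _ → q)
    cauchy-const q ε 0<ε = 0 , λ _ _ _ _ → ∣p-p∣<ε q 0<ε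

    cauchy-+ : ∀ x y → Cauchy (λ i → seq x i ℚ.+ seq y i)
    cauchy-+ x y = halve
      (λ ε → ∃[ N ] (∀ i j → N ℕ.≤ i → N ℕ.≤ j →
        ∣ (seq x i ℚ.+ seq y i) ℚ.- (seq x j ℚ.+ seq y j) ∣ < ε))
      λ ε 0<ε → let M , f = cauchy x ε 0<ε ; N , g = cauchy y ε 0<ε in
        M ℕ.⊔ N , λ i j i≥ j≥ →
          subst (λ t → ∣ t ∣ < ε ℚ.+ ε)
            (≡.sym (sum-difference (seq x i) (seq y i) (seq x j) (seq y j)))
            (triangle {seq x i ℚ.- seq x j} {seq y i ℚ.- seq y j}
              (f i j (max₁ M N i≥) (max₁ M N j≥)) (g i j (max₂ M N i≥) (max₂ M N j≥)))

    cauchy-neg : ∀ x → Cauchy (λ i → ℚ.- seq x i)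
    cauchy-neg x ε 0<ε = let N , f = cauchy x ε 0<ε in
      N , λ i j i≥ j≥ → subst (_< ε) (neg-difference (seq x i) (seq x j)) (f i j i≥ j≥)

    cauchy-* : ∀ x y → Cauchy (λ i → seq x i ℚ.* seq y i)
    cauchy-* x y =
      let B , 0<B , P , b = bounded x ; C , 0<C , Q , c = bounded y in rescale
      (λ ε → ∃[ N ] (∀ i j → N ℕ.≤ i → N ℕ.≤ j →
        ∣ (seq x i ℚ.* seq y i) ℚ.- (seq x j ℚ.* seq y j) ∣ < ε))
      (C ℚ.+ B) (0<+ 0<C 0<B)
      λ ε 0<ε → let M , f = cauchy x ε 0<ε ; N , g = cauchy y ε 0<ε in
        (P ℕ.⊔ Q) ℕ.⊔ (M ℕ.⊔ N) , λ i j i≥ j≥ →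
          let i₁ = max₁ (P ℕ.⊔ Q) (M ℕ.⊔ N) i≥ ; i₂ = max₂ (P ℕ.⊔ Q) (M ℕ.⊔ N) i≥
              j₁ = max₁ (P ℕ.⊔ Q) (M ℕ.⊔ N) j≥ ; j₂ = max₂ (P ℕ.⊔ Q) (M ℕ.⊔ N) j≥
          in close-* {seq x i} {seq y i} {seq x j} {seq y j}
               (c i (max₂ P Q i₁)) (b j (max₁ P Q j₁))
               (f i j (max₁ M N i₂) (max₁ M N j₂)) (g i j (max₂ M N i₂) (max₂ M N j₂))

infixl 6 _+ℝ_
infixl 7 _*ℝ_
infix  8 -ℝ_

ratℝ : ℚ → ℝ
ratℝ q = mkℝ (λ _ → q) (cauchy-const q)

0ℝ 1ℝ : ℝ
0ℝ = ratℝ 0ℚ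
1ℝ = ratℝ 1ℚ

_+ℝ_ _*ℝ_ : ℝ → ℝ → ℝ
x +ℝ y = mkℝ (λ i → seq x i ℚ.+ seq y i) (cauchy-+ x y)
x *ℝ y = mkℝ (λ i → seq x i ℚ.* seq y i) (cauchy-* x y)

-ℝ_ : ℝ → ℝ
-ℝ x = mkℝ (λ i → ℚ.- seq x i) (cauchy-neg x)

opaque
  eventually⇒≈ℝ : ∀ {x y} N → (∀ i → N ℕ.≤ i → seq x i ≡ seq y i) → x ≈ℝ y
  eventually⇒≈ℝ {x} {y} N h ε 0<ε = N , λ i N≤i →
    subst (λ t → ∣ seq x i ℚ.- t ∣ < ε) (h i N≤i) (∣p-p∣<ε (seq x i) 0<ε)

  pointwise⇒≈ℝ : ∀ {x y} → (∀ i → seq x i ≡ seq y i) → x ≈ℝ y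
  pointwise⇒≈ℝ {x} {y} h = eventually⇒≈ℝ {x} {y} 0 λ i _ → h i

  ≈ℝ-refl : ∀ {x} → x ≈ℝ x
  ≈ℝ-refl {x} = pointwise⇒≈ℝ {x} {x} λ _ → ≡.refl

  ≈ℝ-sym : ∀ {x y} → x ≈ℝ y → y ≈ℝ x
  ≈ℝ-sym {x} {y} h ε 0<ε = let N , f = h ε 0<ε in
    N , λ i i≥ → subst (_< ε) (∣p-q∣≡∣q-p∣ (seq x i) (seq y i)) (f i i≥)

  ≈ℝ-trans : ∀ {x y z} → x ≈ℝ y → y ≈ℝ z → x ≈ℝ z
  ≈ℝ-trans {x} {y} {z} h k = halve
    (λ ε → ∃[ N ] (∀ i → N ℕ.≤ i → ∣ seq x i ℚ.- seq z i ∣ < ε))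
    λ ε 0<ε → let M , f = h ε 0<ε ; N , g = k ε 0<ε in
      M ℕ.⊔ N , λ i i≥ → subst (λ t → ∣ t ∣ < ε ℚ.+ ε) (eq (seq x i) (seq y i) (seq z i))
        (triangle {seq x i ℚ.- seq y i} {seq y i ℚ.- seq z i}
          (f i (max₁ M N i≥)) (g i (max₂ M N i≥)))
    where
    eq : ∀ p q r → (p ℚ.- q) ℚ.+ (q ℚ.- r) ≡ p ℚ.- r
    eq = solve 3 (λ p q r → (p :+ :- q) :+ (q :+ :- r) := p :+ :- r) ≡.refl
      where open +-*-Solver

  +ℝ-cong : ∀ {x x′ y y′} → x ≈ℝ x′ → y ≈ℝ y′ → x +ℝ y ≈ℝ x′ +ℝ y′
  +ℝ-cong {x} {x′} {y} {y′} h k = halve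
    (λ ε → ∃[ N ] (∀ i → N ℕ.≤ i →
      ∣ (seq x i ℚ.+ seq y i) ℚ.- (seq x′ i ℚ.+ seq y′ i) ∣ < ε))
    λ ε 0<ε → let M , f = h ε 0<ε ; N , g = k ε 0<ε in
      M ℕ.⊔ N , λ i i≥ →
        subst (λ t → ∣ t ∣ < ε ℚ.+ ε)
          (≡.sym (sum-difference (seq x i) (seq y i) (seq x′ i) (seq y′ i)))
          (triangle {seq x i ℚ.- seq x′ i} {seq y i ℚ.- seq y′ i}
            (f i (max₁ M N i≥)) (g i (max₂ M N i≥)))

  -ℝ-cong : ∀ {x y} → x ≈ℝ y → -ℝ x ≈ℝ -ℝ y
  -ℝ-cong {x} {y} h ε 0<ε = let N , f = h ε 0<ε in
    N , λ i i≥ → subst (_< ε) (neg-difference (seq x i) (seq y i)) (f i i≥)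

  *ℝ-cong : ∀ {x x′ y y′} → x ≈ℝ x′ → y ≈ℝ y′ → x *ℝ y ≈ℝ x′ *ℝ y′
  *ℝ-cong {x} {x′} {y} {y′} h k =
    let B , 0<B , P , b = bounded x′ ; C , 0<C , Q , c = bounded y in rescale
    (λ ε → ∃[ N ] (∀ i → N ℕ.≤ i →
      ∣ (seq x i ℚ.* seq y i) ℚ.- (seq x′ i ℚ.* seq y′ i) ∣ < ε))
    (C ℚ.+ B) (0<+ 0<C 0<B)
    λ ε 0<ε → let M , f = h ε 0<ε ; N , g = k ε 0<ε in
      (P ℕ.⊔ Q) ℕ.⊔ (M ℕ.⊔ N) , λ i i≥ →
        let i₁ = max₁ (P ℕ.⊔ Q) (M ℕ.⊔ N) i≥ ; i₂ = max₂ (P ℕ.⊔ Q) (M ℕ.⊔ N) i≥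
        in close-* {seq x i} {seq y i} {seq x′ i} {seq y′ i}
             (c i (max₂ P Q i₁)) (b i (max₁ P Q i₁)) (f i (max₁ M N i₂)) (g i (max₂ M N i₂))

private
  opaque
    stable : ∀ x y δ → 0ℚ < δ →
             ∃[ N ] (∀ k → N ℕ.≤ k → δ ℚ.+ δ ℚ.+ δ < ∣ seq x k ℚ.- seq y k ∣ → x #ℝ y)
    stable x y δ 0<δ = let M , f = cauchy x δ 0<δ ; N , g = cauchy y δ 0<δ in
      M ℕ.⊔ N , λ k k≥ h → δ , 0<δ , M ℕ.⊔ N , λ i i≥ →
        let t = seq x i ℚ.- seq y i
            fk = f k i (max₁ M N k≥) (max₁ M N i≥)
            gk = g i k (max₂ M N i≥) (max₂ M N k≥)
        in ℚ.≰⇒> λ t≤δ → ℚ.<-asym h (subst (_< δ ℚ.+ δ ℚ.+ δ)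
             (cong ∣_∣ (eq (seq x k) (seq y k) (seq x i) (seq y i)))
             (ℚ.≤-<-trans
               (ℚ.∣p+q∣≤∣p∣+∣q∣ ((seq x k ℚ.- seq x i) ℚ.+ t) (seq y i ℚ.- seq y k))
               (ℚ.+-mono-<
                 (ℚ.≤-<-trans (ℚ.∣p+q∣≤∣p∣+∣q∣ (seq x k ℚ.- seq x i) t) (ℚ.+-mono-<-≤ fk t≤δ))
                 gk)))
      where
      eq : ∀ p q r s → ((p ℚ.- r) ℚ.+ (r ℚ.- s)) ℚ.+ (s ℚ.- q) ≡ p ℚ.- q
      eq = solve 4 (λ p q r s → ((p :+ :- r) :+ (r :+ :- s)) :+ (s :+ :- q) := p :+ :- q) ≡.refl
        where open +-*-Solver

opaque
  #ℝ-irrefl : ∀ {x y} → x ≈ℝ y → ¬ (x #ℝ y)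
  #ℝ-irrefl h (ε , 0<ε , M , f) = let N , g = h ε 0<ε in
    ℚ.<-asym (f (M ℕ.⊔ N) (ℕ.m≤m⊔n M N)) (g (M ℕ.⊔ N) (ℕ.m≤n⊔m M N))

  #ℝ-sym : ∀ {x y} → x #ℝ y → y #ℝ x
  #ℝ-sym {x} {y} (ε , 0<ε , N , f) =
    ε , 0<ε , N , λ i i≥ → subst (ε <_) (∣p-q∣≡∣q-p∣ (seq x i) (seq y i)) (f i i≥)

  #ℝ-cotrans : ∀ {x y} → x #ℝ y → ∀ z → (x #ℝ z) ⊎ (z #ℝ y)
  #ℝ-cotrans {x} {y} (ε , 0<ε , N , f) z = rescale
    (λ ε → (∀ i → N ℕ.≤ i → ε < ∣ seq x i ℚ.- seq y i ∣) → (x #ℝ z) ⊎ (z #ℝ y))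
    six (0<+ (0<+ 0<1 (0<+ 0<1 0<1)) (0<+ 0<1 (0<+ 0<1 0<1)))
    (λ δ 0<δ → go δ (stable x z δ 0<δ) (stable z y δ 0<δ))
    ε 0<ε f
    where
    six : ℚ
    six = (1ℚ ℚ.+ (1ℚ ℚ.+ 1ℚ)) ℚ.+ (1ℚ ℚ.+ (1ℚ ℚ.+ 1ℚ))
    eq : ∀ δ → six ℚ.* δ ≡ (δ ℚ.+ δ ℚ.+ δ) ℚ.+ (δ ℚ.+ δ ℚ.+ δ)
    eq = solve 1 (λ d → ((con 1ℚ :+ (con 1ℚ :+ con 1ℚ)) :+ (con 1ℚ :+ (con 1ℚ :+ con 1ℚ))) :* d
                          := (d :+ d :+ d) :+ (d :+ d :+ d)) ≡.refl
      where open +-*-Solver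
    eq′ : ∀ p q r → (p ℚ.- r) ℚ.+ (r ℚ.- q) ≡ p ℚ.- q
    eq′ = solve 3 (λ p q r → (p :+ :- r) :+ (r :+ :- q) := p :+ :- q) ≡.refl
      where open +-*-Solver
    go : ∀ δ →
         ∃[ M ] (∀ k → M ℕ.≤ k → δ ℚ.+ δ ℚ.+ δ < ∣ seq x k ℚ.- seq z k ∣ → x #ℝ z) →
         ∃[ M ] (∀ k → M ℕ.≤ k → δ ℚ.+ δ ℚ.+ δ < ∣ seq z k ℚ.- seq y k ∣ → z #ℝ y) →
         (∀ i → N ℕ.≤ i → six ℚ.* δ < ∣ seq x i ℚ.- seq y i ∣) →
         (x #ℝ z) ⊎ (z #ℝ y)
    go δ (P , a) (Q , b) h = decide
      where
      k : ℕ
      k = N ℕ.⊔ (P ℕ.⊔ Q)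
      k≥ : P ℕ.⊔ Q ℕ.≤ k
      k≥ = max₂ N (P ℕ.⊔ Q) ℕ.≤-refl
      decide : (x #ℝ z) ⊎ (z #ℝ y)
      decide with (δ ℚ.+ δ ℚ.+ δ) ℚ.<? ∣ seq x k ℚ.- seq z k ∣
      ... | yes p = inj₁ (a k (max₁ P Q k≥) p)
      ... | no ¬p with (δ ℚ.+ δ ℚ.+ δ) ℚ.<? ∣ seq z k ℚ.- seq y k ∣
      ... | yes q = inj₂ (b k (max₂ P Q k≥) q)
      ... | no ¬q = ⊥-elim (ℚ.<-irrefl ≡.refl (ℚ.<-≤-trans
        (subst (_< ∣ seq x k ℚ.- seq y k ∣) (eq δ) (h k (max₁ N (P ℕ.⊔ Q) ℕ.≤-refl)))
        (subst (λ t → ∣ t ∣ ≤ _) (eq′ (seq x k) (seq y k) (seq z k))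
          (ℚ.≤-trans (ℚ.∣p+q∣≤∣p∣+∣q∣ (seq x k ℚ.- seq z k) (seq z k ℚ.- seq y k))
            (ℚ.+-mono-≤ (ℚ.≮⇒≥ ¬p) (ℚ.≮⇒≥ ¬q))))))

  #ℝ-tight : ∀ {x y} → ¬ (x #ℝ y) → x ≈ℝ y
  #ℝ-tight {x} {y} ¬x#y = rescale
    (λ ε → ∃[ N ] (∀ i → N ℕ.≤ i → ∣ seq x i ℚ.- seq y i ∣ < ε))
    four (0<+ (0<+ 0<1 0<1) (0<+ 0<1 0<1))
    λ δ 0<δ → let N , f = stable x y δ 0<δ in
      N , λ i i≥ → ℚ.≰⇒> λ 4δ≤ → ¬x#y (f i i≥ (ℚ.<-≤-trans
        (subst (_< four ℚ.* δ) (ℚ.+-identityʳ _)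
          (subst (δ ℚ.+ δ ℚ.+ δ ℚ.+ 0ℚ <_) (eq δ) (ℚ.+-monoʳ-< (δ ℚ.+ δ ℚ.+ δ) 0<δ)))
        4δ≤))
    where
    four : ℚ
    four = (1ℚ ℚ.+ 1ℚ) ℚ.+ (1ℚ ℚ.+ 1ℚ)
    eq : ∀ δ → δ ℚ.+ δ ℚ.+ δ ℚ.+ δ ≡ four ℚ.* δ
    eq = solve 1 (λ d → d :+ d :+ d :+ d :=
                          ((con 1ℚ :+ con 1ℚ) :+ (con 1ℚ :+ con 1ℚ)) :* d) ≡.refl
      where open +-*-Solver

private
  opaque
    ∣p-0∣ : ∀ p → p ℚ.- 0ℚ ≡ p
    ∣p-0∣ = solve 1 (λ p → p :+ :- con 0ℚ := p) ≡.refl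
      where open +-*-Solver

    reciprocalℝ : ∀ x → x #ℝ 0ℝ → ∃[ y ] (x *ℝ y ≈ℝ 1ℝ)
    reciprocalℝ x (ε , 0<ε , N , f) with L , 0<L , εL≡1 ← RationalLemmas.reciprocal ε 0<ε =
      y , eventually⇒≈ℝ {x *ℝ y} {1ℝ} N λ i i≥ → inv-inverse (seq x i) 0<ε (f′ i i≥)
      where
      f′ : ∀ i → N ℕ.≤ i → ε < ∣ seq x i ∣
      f′ i i≥ = subst (λ t → ε < ∣ t ∣) (∣p-0∣ (seq x i)) (f i i≥)
      K : ℚ
      K = (L ℚ.+ 1ℚ) ℚ.* (L ℚ.+ 1ℚ)
      difference : ∀ p q r s → p ℚ.* r ≡ 1ℚ → q ℚ.* s ≡ 1ℚ →
                   (r ℚ.* s) ℚ.* (q ℚ.- p) ≡ r ℚ.- s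
      difference p q r s pr≡1 qs≡1 = ≡.trans (eq p q r s)
        (≡.trans (cong₂ (λ t u → t ℚ.* r ℚ.- u ℚ.* s) qs≡1 pr≡1)
          (cong₂ ℚ._-_ (ℚ.*-identityˡ r) (ℚ.*-identityˡ s)))
        where
        eq : ∀ p q r s → (r ℚ.* s) ℚ.* (q ℚ.- p) ≡ (q ℚ.* s) ℚ.* r ℚ.- (p ℚ.* r) ℚ.* s
        eq = solve 4 (λ p q r s → (r :* s) :* (q :+ :- p)
                                    := (q :* s) :* r :+ :- ((p :* r) :* s)) ≡.refl
          where open +-*-Solver
      inv-cauchy : Cauchy (λ i → inv (seq x i))
      inv-cauchy = rescale
        (λ δ → ∃[ M ] (∀ i j → M ℕ.≤ i → M ℕ.≤ j → ∣ inv (seq x i) ℚ.- inv (seq x j) ∣ < δ))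
        K (0<* (0<+ 0<L 0<1) (0<+ 0<L 0<1))
        λ δ 0<δ → let M , g = cauchy x δ 0<δ in
          N ℕ.⊔ M , λ i j i≥ j≥ →
            let i₁ = f′ i (max₁ N M i≥) ; j₁ = f′ j (max₁ N M j≥)
            in subst (λ t → ∣ t ∣ < K ℚ.* δ)
              (difference (seq x i) (seq x j) (inv (seq x i)) (inv (seq x j))
                (inv-inverse (seq x i) 0<ε i₁) (inv-inverse (seq x j) 0<ε j₁))
              (product {inv (seq x i) ℚ.* inv (seq x j)} {seq x j ℚ.- seq x i}
                (product {inv (seq x i)} {inv (seq x j)}
                  (inv-bound (seq x i) 0<ε i₁ εL≡1) (inv-bound (seq x j) 0<ε j₁ εL≡1))
                (g j i (max₂ N M j≥) (max₂ N M i≥)))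
      y : ℝ
      y = mkℝ (λ i → inv (seq x i)) inv-cauchy

------------------------------------------------------------------------
-- The complex numbers

record ℂ : Set where
  constructor _+i_
  field
    re : ℝ
    im : ℝ
open ℂ public

infix  4 _≈ℂ_ _#ℂ_
infix  5 _+i_
infixl 6 _+ℂ_
infixl 7 _*ℂ_
infix  8 -ℂ_

record _≈ℂ_ (z w : ℂ) : Set where
  constructor _,_
  field
    re-≈ : re z ≈ℝ re w
    im-≈ : im z ≈ℝ im w

data _#ℂ_ (z w : ℂ) : Set where
  re-# : re z #ℝ re w → z #ℂ w
  im-# : im z #ℝ im w → z #ℂ w

_+ℂ_ _*ℂ_ : ℂ → ℂ → ℂ
z +ℂ w = re z +ℝ re w +i im z +ℝ im w
z *ℂ w = re z *ℝ re w +ℝ -ℝ (im z *ℝ im w) +i re z *ℝ im w +ℝ im z *ℝ re w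

-ℂ_ conj : ℂ → ℂ
-ℂ z   = -ℝ re z +i -ℝ im z
conj z = re z +i -ℝ im z

0ℂ 1ℂ : ℂ
0ℂ = 0ℝ +i 0ℝ
1ℂ = 1ℝ +i 0ℝ

private
  opaque
    ≈ℂ-refl : ∀ {z} → z ≈ℂ z
    ≈ℂ-refl {z} = ≈ℝ-refl {re z} , ≈ℝ-refl {im z}

    ≈ℂ-sym : ∀ {z w} → z ≈ℂ w → w ≈ℂ z
    ≈ℂ-sym {z} {w} (p , q) = ≈ℝ-sym {re z} {re w} p , ≈ℝ-sym {im z} {im w} q

    ≈ℂ-trans : ∀ {z w v} → z ≈ℂ w → w ≈ℂ v → z ≈ℂ v
    ≈ℂ-trans {z} {w} {v} (p , q) (p′ , q′) =
      ≈ℝ-trans {re z} {re w} {re v} p p′ , ≈ℝ-trans {im z} {im w} {im v} q q′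

    pointwise⇒≈ℂ : ∀ {z w} → (∀ i → seq (re z) i ≡ seq (re w) i) →
                   (∀ i → seq (im z) i ≡ seq (im w) i) → z ≈ℂ w
    pointwise⇒≈ℂ {z} {w} p q = pointwise⇒≈ℝ {re z} {re w} p , pointwise⇒≈ℝ {im z} {im w} q

    +ℂ-cong : ∀ {z z′ w w′} → z ≈ℂ z′ → w ≈ℂ w′ → z +ℂ w ≈ℂ z′ +ℂ w′
    +ℂ-cong {z} {z′} {w} {w′} (p , q) (r , s) =
      +ℝ-cong {re z} {re z′} {re w} {re w′} p r , +ℝ-cong {im z} {im z′} {im w} {im w′} q s

    -ℂ-cong : ∀ {z w} → z ≈ℂ w → -ℂ z ≈ℂ -ℂ w
    -ℂ-cong {z} {w} (p , q) = -ℝ-cong {re z} {re w} p , -ℝ-cong {im z} {im w} q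

    *ℂ-cong : ∀ {z z′ w w′} → z ≈ℂ z′ → w ≈ℂ w′ → z *ℂ w ≈ℂ z′ *ℂ w′
    *ℂ-cong {z} {z′} {w} {w′} (p , q) (r , s) =
      +ℝ-cong {re z *ℝ re w} {re z′ *ℝ re w′} { -ℝ (im z *ℝ im w)} { -ℝ (im z′ *ℝ im w′)}
        (*ℝ-cong {re z} {re z′} {re w} {re w′} p r)
        (-ℝ-cong {im z *ℝ im w} {im z′ *ℝ im w′}
          (*ℝ-cong {im z} {im z′} {im w} {im w′} q s)) ,
      +ℝ-cong {re z *ℝ im w} {re z′ *ℝ im w′} {im z *ℝ re w} {im z′ *ℝ re w′}
        (*ℝ-cong {re z} {re z′} {im w} {im w′} p s)
        (*ℝ-cong {im z} {im z′} {re w} {re w′} q r)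

    +ℂ-assoc : ∀ x y z → (x +ℂ y) +ℂ z ≈ℂ x +ℂ (y +ℂ z)
    +ℂ-assoc x y z = pointwise⇒≈ℂ {(x +ℂ y) +ℂ z} {x +ℂ (y +ℂ z)}
      (λ i → ℚ.+-assoc (seq (re x) i) (seq (re y) i) (seq (re z) i))
      (λ i → ℚ.+-assoc (seq (im x) i) (seq (im y) i) (seq (im z) i))

    +ℂ-comm : ∀ x y → x +ℂ y ≈ℂ y +ℂ x
    +ℂ-comm x y = pointwise⇒≈ℂ {x +ℂ y} {y +ℂ x}
      (λ i → ℚ.+-comm (seq (re x) i) (seq (re y) i))
      (λ i → ℚ.+-comm (seq (im x) i) (seq (im y) i))

    +ℂ-identityˡ : ∀ x → 0ℂ +ℂ x ≈ℂ x
    +ℂ-identityˡ x = pointwise⇒≈ℂ {0ℂ +ℂ x} {x}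
      (λ i → ℚ.+-identityˡ (seq (re x) i)) (λ i → ℚ.+-identityˡ (seq (im x) i))

    +ℂ-inverseˡ : ∀ x → -ℂ x +ℂ x ≈ℂ 0ℂ
    +ℂ-inverseˡ x = pointwise⇒≈ℂ { -ℂ x +ℂ x} {0ℂ}
      (λ i → ℚ.+-inverseˡ (seq (re x) i)) (λ i → ℚ.+-inverseˡ (seq (im x) i))

    *ℂ-comm : ∀ x y → x *ℂ y ≈ℂ y *ℂ x
    *ℂ-comm x y = pointwise⇒≈ℂ {x *ℂ y} {y *ℂ x}
      (λ i → real (seq (re x) i) (seq (im x) i) (seq (re y) i) (seq (im y) i))
      (λ i → imag (seq (re x) i) (seq (im x) i) (seq (re y) i) (seq (im y) i))
      where
      open +-*-Solver
      real : ∀ a b c d → a ℚ.* c ℚ.- b ℚ.* d ≡ c ℚ.* a ℚ.- d ℚ.* b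
      real = solve 4 (λ a b c d → a :* c :+ :- (b :* d) := c :* a :+ :- (d :* b)) ≡.refl
      imag : ∀ a b c d → a ℚ.* d ℚ.+ b ℚ.* c ≡ c ℚ.* b ℚ.+ d ℚ.* a
      imag = solve 4 (λ a b c d → a :* d :+ b :* c := c :* b :+ d :* a) ≡.refl

    *ℂ-identityˡ : ∀ x → 1ℂ *ℂ x ≈ℂ x
    *ℂ-identityˡ x = pointwise⇒≈ℂ {1ℂ *ℂ x} {x}
      (λ i → real (seq (re x) i) (seq (im x) i)) (λ i → imag (seq (re x) i) (seq (im x) i))
      where
      open +-*-Solver
      real : ∀ a b → 1ℚ ℚ.* a ℚ.- 0ℚ ℚ.* b ≡ a
      real = solve 2 (λ a b → con 1ℚ :* a :+ :- (con 0ℚ :* b) := a) ≡.refl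
      imag : ∀ a b → 1ℚ ℚ.* b ℚ.+ 0ℚ ℚ.* a ≡ b
      imag = solve 2 (λ a b → con 1ℚ :* b :+ con 0ℚ :* a := b) ≡.refl

    *ℂ-assoc : ∀ x y z → (x *ℂ y) *ℂ z ≈ℂ x *ℂ (y *ℂ z)
    *ℂ-assoc x y z = pointwise⇒≈ℂ {(x *ℂ y) *ℂ z} {x *ℂ (y *ℂ z)}
      (λ i → real (seq (re x) i) (seq (im x) i) (seq (re y) i) (seq (im y) i)
                  (seq (re z) i) (seq (im z) i))
      (λ i → imag (seq (re x) i) (seq (im x) i) (seq (re y) i) (seq (im y) i)
                  (seq (re z) i) (seq (im z) i))
      where
      open +-*-Solver
      real : ∀ a b c d e f →
        (a ℚ.* c ℚ.- b ℚ.* d) ℚ.* e ℚ.- (a ℚ.* d ℚ.+ b ℚ.* c) ℚ.* f ≡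
        a ℚ.* (c ℚ.* e ℚ.- d ℚ.* f) ℚ.- b ℚ.* (c ℚ.* f ℚ.+ d ℚ.* e)
      real = solve 6 (λ a b c d e f →
        (a :* c :+ :- (b :* d)) :* e :+ :- ((a :* d :+ b :* c) :* f) :=
        a :* (c :* e :+ :- (d :* f)) :+ :- (b :* (c :* f :+ d :* e))) ≡.refl
      imag : ∀ a b c d e f →
        (a ℚ.* c ℚ.- b ℚ.* d) ℚ.* f ℚ.+ (a ℚ.* d ℚ.+ b ℚ.* c) ℚ.* e ≡
        a ℚ.* (c ℚ.* f ℚ.+ d ℚ.* e) ℚ.+ b ℚ.* (c ℚ.* e ℚ.- d ℚ.* f)
      imag = solve 6 (λ a b c d e f →
        (a :* c :+ :- (b :* d)) :* f :+ (a :* d :+ b :* c) :* e :=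
        a :* (c :* f :+ d :* e) :+ b :* (c :* e :+ :- (d :* f))) ≡.refl

    *ℂ-distribʳ : ∀ x y z → (y +ℂ z) *ℂ x ≈ℂ y *ℂ x +ℂ z *ℂ x
    *ℂ-distribʳ x y z = pointwise⇒≈ℂ {(y +ℂ z) *ℂ x} {y *ℂ x +ℂ z *ℂ x}
      (λ i → real (seq (re x) i) (seq (im x) i) (seq (re y) i) (seq (im y) i)
                  (seq (re z) i) (seq (im z) i))
      (λ i → imag (seq (re x) i) (seq (im x) i) (seq (re y) i) (seq (im y) i)
                  (seq (re z) i) (seq (im z) i))
      where
      open +-*-Solver
      real : ∀ a b c d e f →
        (c ℚ.+ e) ℚ.* a ℚ.- (d ℚ.+ f) ℚ.* b ≡
        (c ℚ.* a ℚ.- d ℚ.* b) ℚ.+ (e ℚ.* a ℚ.- f ℚ.* b)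
      real = solve 6 (λ a b c d e f →
        (c :+ e) :* a :+ :- ((d :+ f) :* b) :=
        (c :* a :+ :- (d :* b)) :+ (e :* a :+ :- (f :* b))) ≡.refl
      imag : ∀ a b c d e f →
        (c ℚ.+ e) ℚ.* b ℚ.+ (d ℚ.+ f) ℚ.* a ≡
        (c ℚ.* b ℚ.+ d ℚ.* a) ℚ.+ (e ℚ.* b ℚ.+ f ℚ.* a)
      imag = solve 6 (λ a b c d e f →
        (c :+ e) :* b :+ (d :+ f) :* a :=
        (c :* b :+ d :* a) :+ (e :* b :+ f :* a)) ≡.refl

    #ℂ-irrefl : ∀ {z w} → z ≈ℂ w → ¬ (z #ℂ w)
    #ℂ-irrefl {z} {w} (p , _) (re-# h) = #ℝ-irrefl {re z} {re w} p h
    #ℂ-irrefl {z} {w} (_ , q) (im-# h) = #ℝ-irrefl {im z} {im w} q h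

    #ℂ-sym : ∀ {z w} → z #ℂ w → w #ℂ z
    #ℂ-sym {z} {w} (re-# h) = re-# (#ℝ-sym {re z} {re w} h)
    #ℂ-sym {z} {w} (im-# h) = im-# (#ℝ-sym {im z} {im w} h)

    #ℂ-cotrans : ∀ {z w} → z #ℂ w → ∀ v → (z #ℂ v) ⊎ (v #ℂ w)
    #ℂ-cotrans {z} {w} (re-# h) v with #ℝ-cotrans {re z} {re w} h (re v)
    ... | inj₁ k = inj₁ (re-# k)
    ... | inj₂ k = inj₂ (re-# k)
    #ℂ-cotrans {z} {w} (im-# h) v with #ℝ-cotrans {im z} {im w} h (im v)
    ... | inj₁ k = inj₁ (im-# k)
    ... | inj₂ k = inj₂ (im-# k)

    #ℂ-tight : ∀ z w → (¬ (z #ℂ w) → z ≈ℂ w) × (z ≈ℂ w → ¬ (z #ℂ w))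
    #ℂ-tight z w =
      (λ ¬h → #ℝ-tight {re z} {re w} (¬h ∘ re-#) , #ℝ-tight {im z} {im w} (¬h ∘ im-#)) ,
      #ℂ-irrefl {z} {w}

    0≤p² : ∀ p → 0ℚ ≤ p ℚ.* p
    0≤p² p = subst (0ℚ ≤_) (eq p)
      (subst (_≤ ∣ p ∣ ℚ.* ∣ p ∣) (ℚ.*-zeroʳ ∣ p ∣)
        (ℚ.*-monoˡ-≤-nonNeg ∣ p ∣ {{ℚ.∣-∣-nonNeg p}} (ℚ.0≤∣p∣ p)))
      where
      eq : ∀ p → ∣ p ∣ ℚ.* ∣ p ∣ ≡ p ℚ.* p
      eq p with ℚ.∣p∣≡p∨∣p∣≡-p p
      ... | inj₁ h = cong₂ ℚ._*_ h h
      ... | inj₂ h = ≡.trans (cong₂ ℚ._*_ h h) (neg-neg p)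
        where
        open +-*-Solver
        neg-neg : ∀ p → (ℚ.- p) ℚ.* (ℚ.- p) ≡ p ℚ.* p
        neg-neg = solve 1 (λ p → (:- p) :* (:- p) := p :* p) ≡.refl

    ε²<p² : ∀ p {ε} → 0ℚ < ε → ε < ∣ p ∣ → ε ℚ.* ε < p ℚ.* p
    ε²<p² p {ε} 0<ε ε<p = subst (ε ℚ.* ε <_)
      (≡.trans (≡.sym (ℚ.∣p*q∣≡∣p∣*∣q∣ p p)) (ℚ.0≤p⇒∣p∣≡p (0≤p² p)))
      (ℚ.<-trans (ℚ.*-monoʳ-<-pos ε {{ℚ.positive 0<ε}} ε<p)
        (ℚ.*-monoˡ-<-pos ∣ p ∣ {{ℚ.positive (ℚ.<-trans 0<ε ε<p)}} ε<p))

    normSq : ℂ → ℝ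
    normSq z = re z *ℝ re z +ℝ im z *ℝ im z

    normSq#0 : ∀ z w → z #ℂ w → normSq (z +ℂ -ℂ w) #ℝ 0ℝ
    normSq#0 z w h = go h
      where
      t : ℂ
      t = z +ℂ -ℂ w
      to∣∣ : ∀ {δ} p q → δ < p ℚ.* p ℚ.+ q ℚ.* q →
             δ < ∣ p ℚ.* p ℚ.+ q ℚ.* q ℚ.- 0ℚ ∣
      to∣∣ {δ} p q = subst (δ <_)
        (≡.sym (≡.trans (cong ∣_∣ (∣p-0∣ (p ℚ.* p ℚ.+ q ℚ.* q)))
          (ℚ.0≤p⇒∣p∣≡p (ℚ.+-mono-≤ (0≤p² p) (0≤p² q)))))
      go : z #ℂ w → normSq t #ℝ 0ℝ
      go (re-# (ε , 0<ε , N , f)) = ε ℚ.* ε , 0<* 0<ε 0<ε , N , λ i i≥ →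
        to∣∣ (seq (re t) i) (seq (im t) i)
          (subst (_< _) (ℚ.+-identityʳ (ε ℚ.* ε))
            (ℚ.+-mono-<-≤ (ε²<p² (seq (re t) i) 0<ε (f i i≥)) (0≤p² (seq (im t) i))))
      go (im-# (ε , 0<ε , N , f)) = ε ℚ.* ε , 0<* 0<ε 0<ε , N , λ i i≥ →
        to∣∣ (seq (re t) i) (seq (im t) i)
          (subst (_< _) (ℚ.+-identityˡ (ε ℚ.* ε))
            (ℚ.+-mono-≤-< (0≤p² (seq (re t) i)) (ε²<p² (seq (im t) i) 0<ε (f i i≥))))

    rightInverse : ∀ z w → z #ℂ w → ∃[ v ] ((z +ℂ -ℂ w) *ℂ v ≈ℂ 1ℂ)
    rightInverse z w h = v ,
      ( ≈ℝ-trans {re (t *ℂ v)} {normSq t *ℝ r} {1ℝ}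
          (pointwise⇒≈ℝ {re (t *ℂ v)} {normSq t *ℝ r}
            λ i → real (seq (re t) i) (seq (im t) i) (seq r i))
          (proj₂ reciprocal-normSq)
      , pointwise⇒≈ℝ {im (t *ℂ v)} {0ℝ}
          λ i → imag (seq (re t) i) (seq (im t) i) (seq r i) )
      where
      open +-*-Solver
      t : ℂ
      t = z +ℂ -ℂ w
      reciprocal-normSq : ∃[ y ] (normSq t *ℝ y ≈ℝ 1ℝ)
      reciprocal-normSq = reciprocalℝ (normSq t) (normSq#0 z w h)
      r : ℝ
      r = proj₁ reciprocal-normSq
      v : ℂ
      v = re t *ℝ r +i -ℝ (im t *ℝ r)
      real : ∀ p q r → p ℚ.* (p ℚ.* r) ℚ.- q ℚ.* (ℚ.- (q ℚ.* r)) ≡ (p ℚ.* p ℚ.+ q ℚ.* q) ℚ.* r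
      real = solve 3 (λ p q r → p :* (p :* r) :+ :- (q :* (:- (q :* r)))
                                  := (p :* p :+ q :* q) :* r) ≡.refl
      imag : ∀ p q r → p ℚ.* (ℚ.- (q ℚ.* r)) ℚ.+ q ℚ.* (p ℚ.* r) ≡ 0ℚ
      imag = solve 3 (λ p q r → p :* (:- (q :* r)) :+ q :* (p :* r) := con 0ℚ) ≡.refl

    rightInverse⇒# : ∀ z w v → (z +ℂ -ℂ w) *ℂ v ≈ℂ 1ℂ → z #ℂ w
    rightInverse⇒# z w v (h , _) = go (bounded (re v)) (bounded (im v))
      where
      t : ℂ
      t = z +ℂ -ℂ w
      go : ∃[ A ] (0ℚ < A × ∃[ P ] (∀ i → P ℕ.≤ i → ∣ seq (re v) i ∣ < A)) →
           ∃[ B ] (0ℚ < B × ∃[ Q ] (∀ i → Q ℕ.≤ i → ∣ seq (im v) i ∣ < B)) → z #ℂ w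
      go (A , 0<A , P , a) (B , 0<B , Q , b)
        with L , 0<L , KL≡1 ← RationalLemmas.reciprocal
               ((1ℚ ℚ.+ 1ℚ ℚ.+ 1ℚ) ℚ.* (A ℚ.+ B ℚ.+ 1ℚ))
               (0<* (0<+ (0<+ 0<1 0<1) 0<1) (0<+ (0<+ 0<A 0<B) 0<1))
        with M , f ← stable (re z) (re w) L 0<L
        with N , g ← stable (im z) (im w) L 0<L
        with R , e ← h (L ℚ.+ L ℚ.+ L) (0<+ (0<+ 0<L 0<L) 0<L) = decide
        where
        L₃ : ℚ
        L₃ = L ℚ.+ L ℚ.+ L
        k : ℕ
        k = ((P ℕ.⊔ Q) ℕ.⊔ (M ℕ.⊔ N)) ℕ.⊔ R
        k′ : (P ℕ.⊔ Q) ℕ.⊔ (M ℕ.⊔ N) ℕ.≤ k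
        k′ = ℕ.m≤m⊔n _ R
        k₁ : P ℕ.⊔ Q ℕ.≤ k
        k₁ = max₁ (P ℕ.⊔ Q) (M ℕ.⊔ N) k′
        k₂ : M ℕ.⊔ N ℕ.≤ k
        k₂ = max₂ (P ℕ.⊔ Q) (M ℕ.⊔ N) k′
        p q r s : ℚ
        p = seq (re t) k
        q = seq (im t) k
        r = seq (re v) k
        s = seq (im v) k
        1-split : ∀ x y → x ℚ.+ ℚ.- (x ℚ.- y ℚ.- 1ℚ) ℚ.+ ℚ.- y ≡ 1ℚ
        1-split = solve 2 (λ x y → x :+ :- (x :+ :- y :+ :- con 1ℚ) :+ :- y := con 1ℚ) ≡.refl
          where open +-*-Solver
        total : L₃ ℚ.* A ℚ.+ L₃ ℚ.+ L₃ ℚ.* B ≡ 1ℚ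
        total = ≡.trans (eq A B L) KL≡1
          where
          open +-*-Solver
          eq : ∀ A B L → (L ℚ.+ L ℚ.+ L) ℚ.* A ℚ.+ (L ℚ.+ L ℚ.+ L) ℚ.+ (L ℚ.+ L ℚ.+ L) ℚ.* B
                 ≡ ((1ℚ ℚ.+ 1ℚ ℚ.+ 1ℚ) ℚ.* (A ℚ.+ B ℚ.+ 1ℚ)) ℚ.* L
          eq = solve 3 (λ A B L → (L :+ L :+ L) :* A :+ (L :+ L :+ L) :+ (L :+ L :+ L) :* B :=
            ((con 1ℚ :+ con 1ℚ :+ con 1ℚ) :* (A :+ B :+ con 1ℚ)) :* L) ≡.refl
        small : ∀ {x y C} → ∣ x ∣ ≤ L₃ → ∣ y ∣ < C → ∣ x ℚ.* y ∣ ≤ L₃ ℚ.* C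
        small {x} {y} {C} x≤ y< = subst (_≤ L₃ ℚ.* C) (≡.sym (ℚ.∣p*q∣≡∣p∣*∣q∣ x y))
          (ℚ.≤-trans (ℚ.*-monoʳ-≤-nonNeg ∣ y ∣ {{ℚ.∣-∣-nonNeg y}} x≤)
            (ℚ.*-monoˡ-≤-nonNeg L₃ {{ℚ.nonNegative (ℚ.≤-trans (ℚ.0≤∣p∣ x) x≤)}} (ℚ.<⇒≤ y<)))
        absurd : ∣ p ∣ ≤ L₃ → ∣ q ∣ ≤ L₃ → 1ℚ < 1ℚ
        absurd p≤ q≤ = ≡.subst₂ (λ x y → ∣ x ∣ < y) (1-split (p ℚ.* r) (q ℚ.* s)) total
          (ℚ.≤-<-trans
            (ℚ.∣p+q∣≤∣p∣+∣q∣ (p ℚ.* r ℚ.+ ℚ.- (p ℚ.* r ℚ.- q ℚ.* s ℚ.- 1ℚ)) (ℚ.- (q ℚ.* s)))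
            (ℚ.+-mono-<-≤
              (ℚ.≤-<-trans
                (ℚ.∣p+q∣≤∣p∣+∣q∣ (p ℚ.* r) (ℚ.- (p ℚ.* r ℚ.- q ℚ.* s ℚ.- 1ℚ)))
                (ℚ.+-mono-≤-< (small {p} {r} p≤ (a k (max₁ P Q k₁)))
                  (subst (_< L₃) (≡.sym (ℚ.∣-p∣≡∣p∣ (p ℚ.* r ℚ.- q ℚ.* s ℚ.- 1ℚ)))
                    (e k (ℕ.m≤n⊔m _ R)))))
              (subst (_≤ L₃ ℚ.* B) (≡.sym (ℚ.∣-p∣≡∣p∣ (q ℚ.* s)))
                (small {q} {s} q≤ (b k (max₂ P Q k₁))))))
        decide : z #ℂ w
        decide with L₃ ℚ.<? ∣ p ∣
        ... | yes 3L<p = re-# (f k (max₁ M N k₂) 3L<p)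
        ... | no 3L≮p with L₃ ℚ.<? ∣ q ∣
        ... | yes 3L<q = im-# (g k (max₂ M N k₂) 3L<q)
        ... | no 3L≮q = ⊥-elim (ℚ.<-irrefl ≡.refl (absurd (ℚ.≮⇒≥ 3L≮p) (ℚ.≮⇒≥ 3L≮q)))

    ℂ-invertible : ∀ {z w} → z #ℂ w →
      ∃[ v ] ((v *ℂ (z +ℂ -ℂ w) ≈ℂ 1ℂ) × ((z +ℂ -ℂ w) *ℂ v ≈ℂ 1ℂ))
    ℂ-invertible {z} {w} h = let v , e = rightInverse z w h in
      v , ≈ℂ-trans {v *ℂ (z +ℂ -ℂ w)} {(z +ℂ -ℂ w) *ℂ v} {1ℂ}
            (*ℂ-comm v (z +ℂ -ℂ w)) e , e

ℂ-commutativeRing : CommutativeRing 0ℓ 0ℓ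
ℂ-commutativeRing = record
  { Carrier = ℂ
  ; _≈_     = _≈ℂ_
  ; _+_     = _+ℂ_
  ; _*_     = _*ℂ_
  ; -_      = -ℂ_
  ; 0#      = 0ℂ
  ; 1#      = 1ℂ
  ; isCommutativeRing = record
    { isRing = record
      { +-isAbelianGroup = record
        { isGroup = record
          { isMonoid = record
            { isSemigroup = record
              { isMagma = record
                { isEquivalence = ≈ℂ-isEquivalence
                ; ∙-cong        = +ℂ-cong
                }
              ; assoc = +ℂ-assoc
              }
            ; identity = comm∧idˡ⇒id ≈ℂ-setoid +ℂ-comm +ℂ-identityˡ
            }
          ; inverse = comm∧invˡ⇒inv ≈ℂ-setoid +ℂ-comm +ℂ-inverseˡ
          ; ⁻¹-cong = -ℂ-cong
          }
        ; comm = +ℂ-comm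
        }
      ; *-cong     = *ℂ-cong
      ; *-assoc    = *ℂ-assoc
      ; *-identity = comm∧idˡ⇒id ≈ℂ-setoid *ℂ-comm *ℂ-identityˡ
      ; distrib    = comm∧distrʳ⇒distr ≈ℂ-setoid +ℂ-cong *ℂ-comm *ℂ-distribʳ
      }
    ; *-comm = *ℂ-comm
    }
  }
  where
  ≈ℂ-isEquivalence : IsEquivalence _≈ℂ_
  ≈ℂ-isEquivalence = record
    { refl  = ≈ℂ-refl
    ; sym   = ≈ℂ-sym
    ; trans = ≈ℂ-trans
    }
  ≈ℂ-setoid : Setoid 0ℓ 0ℓ
  ≈ℂ-setoid = record { isEquivalence = ≈ℂ-isEquivalence }

ℂ-heytingField : HeytingField 0ℓ 0ℓ 0ℓ
ℂ-heytingField = record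
  { _#_ = _#ℂ_
  ; isHeytingField = record
    { isHeytingCommutativeRing = record
      { isCommutativeRing   = CommutativeRing.isCommutativeRing ℂ-commutativeRing
      ; isApartnessRelation = record
        { irrefl  = #ℂ-irrefl
        ; sym     = #ℂ-sym
        ; cotrans = #ℂ-cotrans
        }
      ; #⇒invertible = ℂ-invertible
      ; invertible⇒# = λ {x} {y} (v , _ , e) → rightInverse⇒# x y v e
      }
    ; tight = #ℂ-tight
    }
  }

open HeytingField ℂ-heytingField public
  using (_≈_; _#_; _+_; _*_; -_; _-_; 0#; 1#; heytingCommutativeRing)
open SemiringExp (CommutativeRing.semiring ℂ-commutativeRing) public using (_^_)

private
  module C = CommutativeRing ℂ-commutativeRing

opaque
  conj-cong : ∀ {z w} → z ≈ w → conj z ≈ conj w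
  conj-cong {z} {w} (p , q) = p , -ℝ-cong {im z} {im w} q

  conj-0# : conj 0# ≈ 0#
  conj-0# = pointwise⇒≈ℂ {conj 0#} {0#} (λ _ → ≡.refl) (λ _ → ≡.refl)

  conj-+ : ∀ z w → conj (z + w) ≈ conj z + conj w
  conj-+ z w = pointwise⇒≈ℂ {conj (z + w)} {conj z + conj w} (λ _ → ≡.refl)
    λ i → ℚ.neg-distrib-+ (seq (im z) i) (seq (im w) i)

  conj-* : ∀ z w → conj (z * w) ≈ conj z * conj w
  conj-* z w = pointwise⇒≈ℂ {conj (z * w)} {conj z * conj w}
    (λ i → real (seq (re z) i) (seq (im z) i) (seq (re w) i) (seq (im w) i))
    (λ i → imag (seq (re z) i) (seq (im z) i) (seq (re w) i) (seq (im w) i))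
    where
    open +-*-Solver
    real : ∀ a b c d → a ℚ.* c ℚ.- b ℚ.* d ≡ a ℚ.* c ℚ.- (ℚ.- b) ℚ.* (ℚ.- d)
    real = solve 4 (λ a b c d → a :* c :+ :- (b :* d)
                                  := a :* c :+ :- ((:- b) :* (:- d))) ≡.refl
    imag : ∀ a b c d → ℚ.- (a ℚ.* d ℚ.+ b ℚ.* c) ≡ a ℚ.* (ℚ.- d) ℚ.+ (ℚ.- b) ℚ.* c
    imag = solve 4 (λ a b c d → :- (a :* d :+ b :* c) := a :* (:- d) :+ (:- b) :* c) ≡.refl

  conj-involutive : ∀ z → conj (conj z) ≈ z
  conj-involutive z = pointwise⇒≈ℂ {conj (conj z)} {z} (λ _ → ≡.refl)
    λ i → neg-neg (seq (im z) i)
    where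
    open +-*-Solver
    neg-neg : ∀ p → ℚ.- (ℚ.- p) ≡ p
    neg-neg = solve 1 (λ p → :- (:- p) := p) ≡.refl

  #⇒-#0 : ∀ {z w} → z # w → w - z # 0#
  #⇒-#0 {z} {w} z#w = let v , _ , e = ℂ-invertible (#ℂ-sym z#w) in
    HeytingProperties.invertibleʳ⇒# heytingCommutativeRing
      (v , C.trans (C.*-congʳ (x-0≈x (w - z))) e)
    where open HeytingProperties heytingCommutativeRing using (x-0≈x)

infix 8 _⁻¹⟨_⟩
infixr 8 _^ᶻ_⟨_⟩

_⁻¹⟨_⟩ : ∀ z → z # 0# → ℂ
z ⁻¹⟨ z#0 ⟩ = proj₁ (HeytingField.#⇒invertible ℂ-heytingField z#0)

_^ᶻ_⟨_⟩ : ∀ z → ℤ → z # 0# → ℂ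
z ^ᶻ (+ k)    ⟨ z#0 ⟩ = z ^ k
z ^ᶻ -[1+ k ] ⟨ z#0 ⟩ = (z ⁻¹⟨ z#0 ⟩) ^ suc k

opaque
  *-⁻¹ : ∀ z (z#0 : z # 0#) → z * z ⁻¹⟨ z#0 ⟩ ≈ 1#
  *-⁻¹ z z#0 = C.trans
    (C.*-congʳ (C.sym (x-0≈x z)))
    (proj₂ (proj₂ (HeytingField.#⇒invertible ℂ-heytingField z#0)))
    where
    open HeytingProperties heytingCommutativeRing using (x-0≈x)
    v : ℂ
    v = z ⁻¹⟨ z#0 ⟩

  ⁻¹-#0 : ∀ z (z#0 : z # 0#) → z ⁻¹⟨ z#0 ⟩ # 0#
  ⁻¹-#0 z z#0 = HeytingProperties.invertibleˡ⇒# heytingCommutativeRing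
    (z , C.trans
      (C.*-congˡ (x-0≈x v)) (*-⁻¹ z z#0))
    where
    open HeytingProperties heytingCommutativeRing using (x-0≈x)
    v : ℂ
    v = z ⁻¹⟨ z#0 ⟩

------------------------------------------------------------------------
-- Determinants

module Determinant {c ℓ} (R : CommutativeRing c ℓ) where

  private
    module R where
      open CommutativeRing R public
      open SemiringExp semiring public using (_^_)
      open SemiringSum semiring public using (sum)

  -- Laplace expansion along the first row.
  det : ∀ {k} → (Fin k → Fin k → R.Carrier) → R.Carrier
  det {zero}  M = R.1#
  det {suc k} M = R.sum λ j →
    (R.- R.1#) R.^ toℕ j R.* M zero j R.* det (λ r s → M (suc r) (punchIn j s))

------------------------------------------------------------------------
-- The Hilbert space ℓ²(X) of a finite set X, given with an enumeration

ℓ² : Set → Set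
ℓ² X = X → ℂ

ℓ²-leftModule : Set → LeftModule C.ring 0ℓ 0ℓ
ℓ²-leftModule X = record
  { Carrierᴹ = ℓ² X
  ; _≈ᴹ_ = λ f g → ∀ x → f x ≈ g x
  ; _+ᴹ_ = λ f g x → f x + g x
  ; _*ₗ_ = λ z f x → z * f x
  ; 0ᴹ   = λ _ → 0#
  ; -ᴹ_  = λ f x → - f x
  ; isLeftModule = record
    { isLeftSemimodule = record
      { +ᴹ-isCommutativeMonoid =
          Pointwise.isCommutativeMonoid X C.+-isCommutativeMonoid
      ; isPreleftSemimodule = record
        { *ₗ-cong      = λ p q x → C.*-cong p (q x)
        ; *ₗ-zeroˡ     = λ f x → C.zeroˡ (f x)
        ; *ₗ-distribʳ  = λ f z w x → C.distribʳ (f x) z w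
        ; *ₗ-identityˡ = λ f x → C.*-identityˡ (f x)
        ; *ₗ-assoc     = λ z w f x → C.*-assoc z w (f x)
        ; *ₗ-zeroʳ     = λ z x → C.zeroʳ z
        ; *ₗ-distribˡ  = λ z f g x → C.distribˡ z (f x) (g x)
        }
      }
    ; -ᴹ‿cong    = λ p x → C.-‿cong (p x)
    ; -ᴹ‿inverse = (λ f x → C.-‿inverseˡ (f x)) , (λ f x → C.-‿inverseʳ (f x))
    }
  }

IsLinear : ∀ {X Y} → (ℓ² X → ℓ² Y) → Set
IsLinear {X} {Y} = LeftModuleMorphisms.IsLeftModuleHomomorphism
  (LeftModule.rawLeftModule (ℓ²-leftModule X)) (LeftModule.rawLeftModule (ℓ²-leftModule Y))

infix  4 _≋_
infixl 6 _⊖_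
infixl 6 _⊕_
infixr 7 _•_

_≋_ : ∀ {X Y} → Rel (ℓ² X → ℓ² Y) 0ℓ
S ≋ T = ∀ f y → S f y ≈ T f y

_⊕_ _⊖_ : ∀ {X Y} → (ℓ² X → ℓ² Y) → (ℓ² X → ℓ² Y) → ℓ² X → ℓ² Y
(S ⊕ T) f y = S f y + T f y
(S ⊖ T) f y = S f y - T f y

_•_ : ∀ {X Y} → ℂ → (ℓ² X → ℓ² Y) → ℓ² X → ℓ² Y
(z • T) f y = z * T f y

I : ∀ {X} → ℓ² X → ℓ² X
I = id

open CommutativeMonoidSum C.+-commutativeMonoid 
  using (sum; sum-cong-≋; sum-cong-≗; ∑-comm; sum-replicate-zero)
open SemiringSum C.semiring using (*-distribˡ-sum; *-distribʳ-sum)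

module _ {k} {X : Set} (X≃ : Fin k ↔ X) where

  open Inverse X≃ using (to; from)

  ⟨_,_⟩ : ℓ² X → ℓ² X → ℂ
  ⟨ f , g ⟩ = sum λ i → f (to i) * conj (g (to i))

  δ : X → ℓ² X
  δ x y = if does (from x Fin.≟ from y) then 1# else 0#

  -- The determinant of the matrix of T in the basis of the δ x.
  detOp : (ℓ² X → ℓ² X) → ℂ
  detOp T = Determinant.det ℂ-commutativeRing λ i j → T (δ (to j)) (to i)

module _ {k l} {X Y : Set} (X≃ : Fin k ↔ X) (Y≃ : Fin l ↔ Y) where

  adjoint : (ℓ² X → ℓ² Y) → ℓ² Y → ℓ² X
  adjoint T f x = ⟨_,_⟩ Y≃ f (T (δ X≃ x))

  open SetoidReasoning C.setoid

  opaque
    sum-δ : ∀ {k} (f : Fin k → ℂ) i →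
            sum (λ j → f j * (if does (j Fin.≟ i) then 1# else 0#)) ≈ f i
    sum-δ {suc k} f zero = begin
      f zero * 1# + sum (λ j → f (suc j) * 0#)
        ≈⟨ C.+-cong (C.*-identityʳ (f zero)) (sum-cong-≋ λ j → C.zeroʳ (f (suc j))) ⟩
      f zero + sum (λ (_ : Fin k) → 0#)
        ≈⟨ C.+-congˡ (sum-replicate-zero k) ⟩
      f zero + 0#
        ≈⟨ C.+-identityʳ (f zero) ⟩
      f zero ∎
    sum-δ {suc k} f (suc i) = begin
      f zero * 0# + sum (λ j → f (suc j) * (if does (j Fin.≟ i) then 1# else 0#))
        ≈⟨ C.+-cong (C.zeroʳ (f zero)) (sum-δ (λ j → f (suc j)) i) ⟩
      0# + f (suc i)
        ≈⟨ C.+-identityˡ (f (suc i)) ⟩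
      f (suc i) ∎

    conj-sum : ∀ {k} (f : Fin k → ℂ) → conj (sum f) ≈ sum (λ i → conj (f i))
    conj-sum {zero}  f = conj-0#
    conj-sum {suc k} f = C.trans (conj-+ (f zero) (sum λ i → f (suc i)))
      (C.+-congˡ (conj-sum λ i → f (suc i)))

    module _ {T : ℓ² X → ℓ² Y} (linear : IsLinear T) where

      open LeftModuleMorphisms.IsLeftModuleHomomorphism linear
      open Inverse

      linear-sum : ∀ {j} (c : Fin j → ℂ) (v : Fin j → ℓ² X) y →
                   T (λ x → sum λ i → c i * v i x) y ≈ sum (λ i → c i * T (v i) y)
      linear-sum {zero}  c v y = 0ᴹ-homo y
      linear-sum {suc j} c v y = begin
        T (λ x → c zero * v zero x + sum (λ i → c (suc i) * v (suc i) x)) y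
          ≈⟨ +ᴹ-homo (λ x → c zero * v zero x) (λ x → sum λ i → c (suc i) * v (suc i) x) y ⟩
        T (λ x → c zero * v zero x) y + T (λ x → sum λ i → c (suc i) * v (suc i) x) y
          ≈⟨ C.+-cong (*ₗ-homo (c zero) (v zero) y)
                      (linear-sum (λ i → c (suc i)) (λ i → v (suc i)) y) ⟩
        c zero * T (v zero) y + sum (λ i → c (suc i) * T (v (suc i)) y) ∎

      expand : ∀ ω y → T ω y ≈ sum (λ j → ω (to X≃ j) * T (δ X≃ (to X≃ j)) y)
      expand ω y = C.trans (⟦⟧-cong expand-ω y)
        (linear-sum (λ j → ω (to X≃ j)) (λ j → δ X≃ (to X≃ j)) y)
        where
        expand-ω : ∀ x → ω x ≈ sum (λ j → ω (to X≃ j) * δ X≃ (to X≃ j) x)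
        expand-ω x = C.sym (begin
          sum (λ j → ω (to X≃ j) * δ X≃ (to X≃ j) x)
            ≡⟨ sum-cong-≗ (λ j → cong
                 (λ i → ω (to X≃ j) * (if does (i Fin.≟ from X≃ x) then 1# else 0#))
                 (strictlyInverseʳ X≃ j)) ⟩
          sum (λ j → ω (to X≃ j) * (if does (j Fin.≟ from X≃ x) then 1# else 0#))
            ≈⟨ sum-δ (λ j → ω (to X≃ j)) (from X≃ x) ⟩
          ω (to X≃ (from X≃ x))
            ≡⟨ cong ω (strictlyInverseˡ X≃ x) ⟩
          ω x ∎)

      adjoint-isAdjoint : ∀ ω f → ⟨_,_⟩ Y≃ (T ω) f ≈ ⟨_,_⟩ X≃ ω (adjoint T f)
      adjoint-isAdjoint ω f = begin
        sum (λ i → T ω (to Y≃ i) * conj (f (to Y≃ i)))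
          ≈⟨ sum-cong-≋ (λ i → C.*-congʳ (expand ω (to Y≃ i))) ⟩
        sum (λ i → sum (λ j → ω (to X≃ j) * M i j) * conj (f (to Y≃ i)))
          ≈⟨ sum-cong-≋ (λ i → *-distribʳ-sum (conj (f (to Y≃ i)))
                                 (λ j → ω (to X≃ j) * M i j)) ⟩
        sum (λ i → sum (λ j → ω (to X≃ j) * M i j * conj (f (to Y≃ i))))
          ≈⟨ ∑-comm (λ i j → ω (to X≃ j) * M i j * conj (f (to Y≃ i))) ⟩
        sum (λ j → sum (λ i → ω (to X≃ j) * M i j * conj (f (to Y≃ i))))
          ≈⟨ sum-cong-≋ (λ j → sum-cong-≋ λ i →
               C.trans (C.*-assoc (ω (to X≃ j)) (M i j) (conj (f (to Y≃ i))))
                 (C.*-congˡ (flip i j))) ⟩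
        sum (λ j → sum (λ i → ω (to X≃ j) * conj (f (to Y≃ i) * conj (M i j))))
          ≈⟨ sum-cong-≋ (λ j → C.sym (*-distribˡ-sum (ω (to X≃ j))
                                        (λ i → conj (f (to Y≃ i) * conj (M i j))))) ⟩
        sum (λ j → ω (to X≃ j) * sum (λ i → conj (f (to Y≃ i) * conj (M i j))))
          ≈⟨ sum-cong-≋ (λ j → C.*-congˡ
               (C.sym (conj-sum λ i → f (to Y≃ i) * conj (M i j)))) ⟩
        sum (λ j → ω (to X≃ j) * conj (adjoint T f (to X≃ j))) ∎
        where
        M : Fin l → Fin k → ℂ
        M i j = T (δ X≃ (to X≃ j)) (to Y≃ i)
        flip : ∀ i j → M i j * conj (f (to Y≃ i)) ≈ conj (f (to Y≃ i) * conj (M i j))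
        flip i j = C.sym (begin
          conj (f (to Y≃ i) * conj (M i j))
            ≈⟨ conj-* (f (to Y≃ i)) (conj (M i j)) ⟩
          conj (f (to Y≃ i)) * conj (conj (M i j))
            ≈⟨ C.*-congˡ (conj-involutive (M i j)) ⟩
          conj (f (to Y≃ i)) * M i j
            ≈⟨ C.*-comm (conj (f (to Y≃ i))) (M i j) ⟩
          M i j * conj (f (to Y≃ i)) ∎)

------------------------------------------------------------------------
-- Simple graphs

record SimpleGraph (n : ℕ) : Set where
  field
    adj         : Fin n → Fin n → Bool
    symmetric   : ∀ u v → adj u v ≡ adj v u
    irreflexive : ∀ u → adj u u ≡ false

  Adj : Rel (Fin n) 0ℓ
  Adj u v = T (adj u v)

module _ {n} (G : SimpleGraph n) where

  open SimpleGraph G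

  Connected : Set
  Connected = ∀ u v → Star Adj u v

  -- An unordered pair is represented by its increasing ordering.
  Edge : Set
  Edge = Σ[ u ∈ Fin n ] Σ[ v ∈ Fin n ] (u Fin.< v × Adj u v)

  Arc : Set
  Arc = Σ[ u ∈ Fin n ] Σ[ v ∈ Fin n ] Adj u v

  reverse : Arc → Arc
  reverse (u , v , uv) = v , u , subst T (symmetric u v) uv

  reversal : ℓ² Arc → ℓ² Arc
  reversal ω e = ω (reverse e)

  ¬Adj-refl : ∀ {u} → ¬ Adj u u
  ¬Adj-refl {u} = subst T (irreflexive u)

  orientations : Edge ⊎ Edge → Arc
  orientations (inj₁ (u , v , _ , uv)) = u , v , uv
  orientations (inj₂ (u , v , _ , uv)) = reverse (u , v , uv)

  underlying : Arc → Edge ⊎ Edge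
  underlying (u , v , uv) with Fin.<-cmp u v
  ... | tri< u<v _ _    = inj₁ (u , v , u<v , uv)
  ... | tri≈ _ ≡.refl _ = ⊥-elim (¬Adj-refl uv)
  ... | tri> _ _ v<u    = inj₂ (v , u , v<u , subst T (symmetric u v) uv)

  Arc-≡ : ∀ {u v} {p q : Adj u v} → _≡_ {A = Arc} (u , v , p) (u , v , q)
  Arc-≡ {u} {v} {p} {q} = cong (λ r → u , v , r) (T-irrelevant p q)

  Edge-≡ : ∀ {u v} {p q : u Fin.< v × Adj u v} → _≡_ {A = Edge} (u , v , p) (u , v , q)
  Edge-≡ {u} {v} {p , r} {q , s} =
    cong₂ (λ t w → u , v , t , w) (ℕ.<-irrelevant p q) (T-irrelevant r s)

  orientations-underlying : ∀ e → orientations (underlying e) ≡ e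
  orientations-underlying (u , v , uv) with Fin.<-cmp u v
  ... | tri< _ _ _      = ≡.refl
  ... | tri≈ _ ≡.refl _ = ⊥-elim (¬Adj-refl uv)
  ... | tri> _ _ _      = Arc-≡

  underlying-orientations : ∀ e → underlying (orientations e) ≡ e
  underlying-orientations (inj₁ (u , v , u<v , uv)) with Fin.<-cmp u v
  ... | tri< _ _ _    = cong inj₁ Edge-≡
  ... | tri≈ u≮v _ _  = ⊥-elim (u≮v u<v)
  ... | tri> u≮v _ _  = ⊥-elim (u≮v u<v)
  underlying-orientations (inj₂ (u , v , u<v , uv)) with Fin.<-cmp v u
  ... | tri< _ _ u≮v  = ⊥-elim (u≮v u<v)
  ... | tri≈ _ _ u≮v  = ⊥-elim (u≮v u<v)
  ... | tri> _ _ _    = cong inj₂ Edge-≡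

  -- Arc i of the first m is the increasing orientation of edge i; arc m + i is its reverse.
  arcs : ∀ {m} → Fin m ↔ Edge → Fin (m ℕ.+ m) ↔ Arc
  arcs edges =
    mk↔ₛ′ orientations underlying orientations-underlying underlying-orientations
      ↔-∘ ((edges ⊎-↔ edges) ↔-∘ Fin.+↔⊎)

module _ {k} {X : Set} (X≃ : Fin k ↔ X) (U : ℓ² X → ℓ² X) (u : ℂ) where

  zeta : detOp X≃ (I ⊖ u • U) # 0# → ℂ
  zeta p = detOp X≃ (I ⊖ u • U) ⁻¹⟨ p ⟩

  zeta-#0 : ∀ p → zeta p # 0#
  zeta-#0 = ⁻¹-#0 (detOp X≃ (I ⊖ u • U))

{-# OPTIONS --safe #-}
module Submission where

-- Write Y for the matrix of d, S for the arc reversal, c = a − b, w = bu and q = 1 − w². Then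
-- I − uU = (I − wS) − cu SY*Y is the Schur complement of the block I in
--
--   N = ( I       Y      )
--       ( cu SY*  I − wS ).
--
-- Subtracting cu SY* times the top rows from the bottom rows gives det N = det (I − uU).
-- Multiplying the top rows by q and subtracting Y(I + wS) times the bottom rows leaves, as
-- (I + wS)(I − wS) = q I, the block lower triangular matrix with diagonal blocks
-- q I − cu Y(I + wS)SY* and I − wS; since YY* = I, the first is (1 − abu²) I − cu YSY*. As
-- det (I − wS) = qᵐ, this gives qⁿ det (I − uU) = qᵐ det ((1 − abu²) I − cu YSY*), over any
-- commutative ring and without dividing by q.

open import Defs using (module Determinant)
open import Algebra.Bundles using (CommutativeRing)
import Algebra.Properties.Ring as RingProperties
import Algebra.Properties.Semiring.Exp as SemiringExp
import Algebra.Properties.Semiring.Sum as SemiringSum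
import Algebra.Solver.Ring.NaturalCoefficients.Default as NaturalCoefficients
open import Data.Bool.Base using (if_then_else_)
open import Data.Empty using (⊥-elim)
open import Data.Fin.Base as Fin
  using (Fin; zero; suc; toℕ; punchIn; inject₁; splitAt; join; _↑ˡ_; _↑ʳ_)
import Data.Fin.Properties as Fin
open import Data.Integer.Properties using ([1+m]⊖[1+n]≡m⊖n)
open import Data.Nat.Base as ℕ using (ℕ; zero; suc; z≤n; s≤s)
open import Data.Product.Base using (Σ; Σ-syntax; _×_; _,_)
open import Data.Sum.Base as Sum using (_⊎_)
open import Data.Vec.Functional using (Vector; updateAt; _++_)
open import Data.Vec.Functional.Properties
  using (lookup-++ˡ; lookup-++ʳ; updateAt-updates; updateAt-minimal)
open import Function.Base using (_∘_; const)
open import Function.Bundles using (_↔_; Inverse)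
open import Function.Construct.Identity using (↔-id)
open import Relation.Binary.PropositionalEquality as ≡ using (_≡_; _≢_)
import Relation.Binary.Reasoning.Setoid as SetoidReasoning
open import Relation.Nullary using (does; yes; no)
open import Relation.Nullary.Decidable using (dec-true; dec-false)

-- Indices split into two blocks

∀-+ : ∀ k {l p} {P : Fin (k ℕ.+ l) → Set p} →
      (∀ i → P (i ↑ˡ l)) → (∀ j → P (k ↑ʳ j)) → ∀ r → P r
∀-+ zero    left right r       = right r
∀-+ (suc k) left right zero    = left zero
∀-+ (suc k) left right (suc r) = ∀-+ k (left ∘ suc) right r

↑ˡ≢↑ʳ : ∀ k {l} (i : Fin k) (j : Fin l) → i ↑ˡ l ≢ k ↑ʳ j
↑ˡ≢↑ʳ (suc k) (suc i) j eq = ↑ˡ≢↑ʳ k i j (Fin.suc-injective eq)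

-- Arc reversal on positions: with m edges, positions i and m + i hold the two orientations of edge
-- i.
swapHalves : ∀ m → Fin (m ℕ.+ m) → Fin (m ℕ.+ m)
swapHalves m = join m m ∘ Sum.swap ∘ splitAt m

swapHalves-↑ˡ : ∀ m i → swapHalves m (i ↑ˡ m) ≡ m ↑ʳ i
swapHalves-↑ˡ m i = ≡.cong (join m m ∘ Sum.swap) (Fin.splitAt-↑ˡ m i m)

swapHalves-↑ʳ : ∀ m i → swapHalves m (m ↑ʳ i) ≡ i ↑ˡ m
swapHalves-↑ʳ m i = ≡.cong (join m m ∘ Sum.swap) (Fin.splitAt-↑ʳ m m i)

swapHalves-involutive : ∀ m i → swapHalves m (swapHalves m i) ≡ i
swapHalves-involutive m = ∀-+ m
  (λ i → ≡.trans (≡.cong (swapHalves m) (swapHalves-↑ˡ m i)) (swapHalves-↑ʳ m i))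
  (λ i → ≡.trans (≡.cong (swapHalves m) (swapHalves-↑ʳ m i)) (swapHalves-↑ˡ m i))

module MatrixDeterminant {c ℓ} (R : CommutativeRing c ℓ) where

  open CommutativeRing R hiding (zero)
  open RingProperties ring
    using (-‿distribˡ-*; -‿distribʳ-*; -‿involutive; -‿+-comm; x+x≈x⇒x≈0; -1*x≈-x;
           [y-z]x≈yx-zx; //-rightDividesˡ)
  open SemiringExp semiring using (_^_)
  open SemiringSum semiring
  open NaturalCoefficients commutativeSemiring using (solve; _:+_; _:*_; _:^_; _:=_)
  open Determinant R using (det)
  open SetoidReasoning setoid

  -- Laplace expansion and multilinearity in the rows

  Matrix : ℕ → ℕ → Set c
  Matrix k l = Fin k → Fin l → Carrier

  infix 4 _≋ᵛ_
  _≋ᵛ_ : ∀ {k} → Vector Carrier k → Vector Carrier k → Set ℓ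
  v ≋ᵛ w = ∀ s → v s ≈ w s

  sign : ∀ {k} → Fin k → Carrier
  sign j = (- 1#) ^ toℕ j

  minor : ∀ {k} → Matrix (suc k) (suc k) → Fin (suc k) → Matrix k k
  minor A j r s = A (suc r) (punchIn j s)

  sum-zero : ∀ {k} {f : Vector Carrier k} → (∀ i → f i ≈ 0#) → sum f ≈ 0#
  sum-zero {k} h = trans (sum-cong-≋ h) (sum-replicate-zero k)

  det-cong : ∀ {k} {A B : Matrix k k} → (∀ r → A r ≋ᵛ B r) → det A ≈ det B
  det-cong {zero}  A≋B = refl
  det-cong {suc k} A≋B = sum-cong-≋ λ j →
    *-cong (*-congˡ {sign j} (A≋B zero j)) (det-cong λ r s → A≋B (suc r) (punchIn j s))

  det-zero-minors : ∀ {k} (A : Matrix (suc k) (suc k)) →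
                    (∀ j → det (minor A j) ≈ 0#) → det A ≈ 0#
  det-zero-minors A h = sum-zero {f = λ j → sign j * A zero j * det (minor A j)} λ j →
    trans (*-congˡ (h j)) (zeroʳ (sign j * A zero j))

  -- For i = 0 the first-row entries are linear and the minors of all three matrices agree; for
  -- later rows the minors are linear by induction. Scaling and addition are joined because the row
  -- operations below combine them.
  det-linear : ∀ {k} (i : Fin k) x {A B C : Matrix k k} →
               (∀ r → r ≢ i → A r ≋ᵛ C r) → (∀ r → r ≢ i → B r ≋ᵛ C r) →
               (∀ s → C i s ≈ x * A i s + B i s) → det C ≈ x * det A + det B
  det-linear {suc k} i x {A} {B} {C} A≋C B≋C Cᵢ = begin
    sum (term C)                      ≈⟨ sum-cong-≋ (split i A≋C B≋C Cᵢ) ⟩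
    sum (λ j → x * term A j + term B j)
      ≈⟨ ∑-distrib-+ (λ j → x * term A j) (term B) ⟩
    sum (λ j → x * term A j) + det B  ≈⟨ +-congʳ (*-distribˡ-sum x (term A)) ⟨
    x * det A + det B                 ∎
    where
    term : Matrix (suc k) (suc k) → Vector Carrier (suc k)
    term M j = sign j * M zero j * det (minor M j)
    split : ∀ i → (∀ r → r ≢ i → A r ≋ᵛ C r) → (∀ r → r ≢ i → B r ≋ᵛ C r) →
            (∀ s → C i s ≈ x * A i s + B i s) → ∀ j → term C j ≈ x * term A j + term B j
    split zero A≋C B≋C Cᵢ j = begin
      sign j * C zero j * det (minor C j)
        ≈⟨ *-congʳ (*-congˡ (Cᵢ j)) ⟩
      sign j * (x * A zero j + B zero j) * det (minor C j)
        ≈⟨ solve 5 (λ s x a b m → s :* (x :* a :+ b) :* m := x :* (s :* a :* m) :+ s :* b :* m)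
             refl (sign j) x (A zero j) (B zero j) (det (minor C j)) ⟩
      x * (sign j * A zero j * det (minor C j)) + sign j * B zero j * det (minor C j)
        ≈⟨ +-cong (*-congˡ (*-congˡ (det-cong λ r s → A≋C (suc r) (λ ()) (punchIn j s))))
                  (*-congˡ (det-cong λ r s → B≋C (suc r) (λ ()) (punchIn j s))) ⟨
      x * term A j + term B j ∎
    split (suc i) A≋C B≋C Cᵢ j = begin
      sign j * C zero j * det (minor C j)
        ≈⟨ *-congˡ (det-linear i x (λ r r≢i s → A≋C (suc r) (r≢i ∘ Fin.suc-injective) (punchIn j s))
             (λ r r≢i s → B≋C (suc r) (r≢i ∘ Fin.suc-injective) (punchIn j s))
             (λ s → Cᵢ (punchIn j s))) ⟩
      sign j * C zero j * (x * det (minor A j) + det (minor B j))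
        ≈⟨ solve 5 (λ s c x a b → s :* c :* (x :* a :+ b) := x :* (s :* c :* a) :+ s :* c :* b)
             refl (sign j) (C zero j) x (det (minor A j)) (det (minor B j)) ⟩
      x * (sign j * C zero j * det (minor A j)) + sign j * C zero j * det (minor B j)
        ≈⟨ +-cong (*-congˡ (*-congʳ (*-congˡ (A≋C zero (λ ()) j))))
                  (*-congʳ (*-congˡ (B≋C zero (λ ()) j))) ⟨
      x * term A j + term B j ∎

  -- The determinant is alternating

  -- In a double Laplace expansion, the hypothesis matches the pair of columns a < b, removed in
  -- this order, with the same pair removed in the opposite order.
  sum-cancel : ∀ {k} (g : Fin (suc k) → Fin k → Carrier) →
               (∀ j l → j Fin.≤ l → g (inject₁ j) l + g (suc l) j ≈ 0#) →
               sum (λ j → sum (g j)) ≈ 0#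
  sum-cancel {zero}  g h = +-identityˡ 0#
  sum-cancel {suc k} g h = begin
    sum (g zero) + sum (λ j → g (suc j) zero + sum (λ l → g (suc j) (suc l)))
      -- Column 0 of `g` is split off to pair with row 0; what remains is a double sum of the same
      -- kind, one size smaller.
      ≈⟨ +-congˡ (∑-distrib-+ (λ j → g (suc j) zero) (λ j → sum (λ l → g (suc j) (suc l)))) ⟩
    sum (g zero) + (sum (λ j → g (suc j) zero) + sum (λ j → sum (λ l → g (suc j) (suc l))))
      ≈⟨ +-congˡ (+-congˡ (sum-cancel (λ j l → g (suc j) (suc l))
           λ j l j≤l → h (suc j) (suc l) (s≤s j≤l))) ⟩
    sum (g zero) + (sum (λ j → g (suc j) zero) + 0#)
      ≈⟨ +-congˡ (+-identityʳ _) ⟩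
    sum (g zero) + sum (λ j → g (suc j) zero)
      ≈⟨ ∑-distrib-+ (g zero) (λ j → g (suc j) zero) ⟨
    sum (λ l → g zero l + g (suc l) zero)
      ≈⟨ sum-zero (λ l → h zero l z≤n) ⟩
    0# ∎

  -- For j ≤ l the columns `inject₁ j` and `suc l` are a pair a < b. Position `l` is that of b once
  -- a is removed, and position `j` that of a once b is removed; removing both leaves the same
  -- columns in either order.
  punchIn-inject₁-≤ : ∀ {k} {j l : Fin k} → j Fin.≤ l → punchIn (inject₁ j) l ≡ suc l
  punchIn-inject₁-≤ {j = zero}              _         = ≡.refl
  punchIn-inject₁-≤ {j = suc j} {l = suc l} (s≤s j≤l) = ≡.cong suc (punchIn-inject₁-≤ j≤l)

  punchIn-suc-≤ : ∀ {k} {j l : Fin k} → j Fin.≤ l → punchIn (suc l) j ≡ inject₁ j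
  punchIn-suc-≤ {j = zero}              _         = ≡.refl
  punchIn-suc-≤ {j = suc j} {l = suc l} (s≤s j≤l) = ≡.cong suc (punchIn-suc-≤ j≤l)

  punchIn-punchIn-≤ : ∀ {k} {j l : Fin (suc k)} → j Fin.≤ l → ∀ s →
                      punchIn (inject₁ j) (punchIn l s) ≡ punchIn (suc l) (punchIn j s)
  punchIn-punchIn-≤ {j = zero}              _         s       = ≡.refl
  punchIn-punchIn-≤ {j = suc j} {l = suc l} (s≤s j≤l) zero    = ≡.refl
  punchIn-punchIn-≤ {j = suc j} {l = suc l} (s≤s j≤l) (suc s) =
    ≡.cong suc (punchIn-punchIn-≤ j≤l s)

  -- A term of the expansion along the first two rows: `j` is the column taken in row 0, `l` the
  -- position of the column taken in row 1 among the remaining ones.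
  double : ∀ {k} → Matrix (suc (suc k)) (suc (suc k)) → Fin (suc (suc k)) → Fin (suc k) → Carrier
  double A j l = sign j * A zero j *
    (sign l * A (suc zero) (punchIn j l) * det (minor (minor A j) l))

  det-double : ∀ {k} (A : Matrix (suc (suc k)) (suc (suc k))) →
               det A ≈ sum (λ j → sum (double A j))
  det-double A = sum-cong-≋ λ j → *-distribˡ-sum (sign j * A zero j)
    (λ l → sign l * A (suc zero) (punchIn j l) * det (minor (minor A j) l))

  swapRows : ∀ {k} → Matrix (suc (suc k)) (suc (suc k)) → Matrix (suc (suc k)) (suc (suc k))
  swapRows A zero          = A (suc zero)
  swapRows A (suc zero)    = A zero
  swapRows A (suc (suc r)) = A (suc (suc r))

  -- Both terms take the same two entries and the same remaining minor; the signs have exponents j +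
  -- l and (l + 1) + j, hence are opposite. `B` is fixed only up to `≈`, so that it can be `A`
  -- itself when the first two rows of `A` agree.
  double-swap : ∀ {k} (A B : Matrix (suc (suc k)) (suc (suc k))) → (∀ r → B r ≋ᵛ swapRows A r) →
                ∀ j l → j Fin.≤ l → double A (inject₁ j) l + double B (suc l) j ≈ 0#
  double-swap A B B≋ j l j≤l = begin
    double A (inject₁ j) l + double B (suc l) j
      ≈⟨ +-cong
           (*-cong (*-congʳ (reflexive (≡.cong ((- 1#) ^_) (Fin.toℕ-inject₁ j))))
             (*-congʳ (*-congˡ (reflexive (≡.cong (A (suc zero)) (punchIn-inject₁-≤ j≤l))))))
           (*-cong (*-congˡ (B≋ zero (suc l)))
             (*-cong (*-congˡ (trans (B≋ (suc zero) (punchIn (suc l) j))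
                 (reflexive (≡.cong (A zero) (punchIn-suc-≤ j≤l)))))
               (det-cong λ r s → trans (B≋ (suc (suc r)) (punchIn (suc l) (punchIn j s)))
                 (reflexive (≡.cong (A (suc (suc r))) (≡.sym (punchIn-punchIn-≤ j≤l s))))))) ⟩
    σ * x * (τ * y * D) + - 1# * τ * y * (σ * x * D)
      ≈⟨ solve 6 (λ e s x t y D → s :* x :* (t :* y :* D) :+ e :* t :* y :* (s :* x :* D) :=
             s :* x :* (t :* y :* D) :+ e :* (s :* x :* (t :* y :* D)))
           refl (- 1#) σ x τ y D ⟩
    σ * x * (τ * y * D) + - 1# * (σ * x * (τ * y * D))
      ≈⟨ +-congˡ (-1*x≈-x _) ⟩
    σ * x * (τ * y * D) + - (σ * x * (τ * y * D))
      ≈⟨ -‿inverseʳ _ ⟩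
    0# ∎
    where
    σ τ x y D : Carrier
    σ = sign j
    τ = sign l
    x = A zero (inject₁ j)
    y = A (suc zero) (suc l)
    D = det (minor (minor A (inject₁ j)) l)

  -- Each term of one double expansion cancels against the term of the other that takes the same two
  -- columns in the opposite order.
  det-swap : ∀ {k} (A : Matrix (suc (suc k)) (suc (suc k))) → det A + det (swapRows A) ≈ 0#
  det-swap A = begin
    det A + det (swapRows A)
      ≈⟨ +-cong (det-double A) (det-double (swapRows A)) ⟩
    sum (λ j → sum (double A j)) + sum (λ j → sum (double (swapRows A) j))
      ≈⟨ ∑-distrib-+ (λ j → sum (double A j)) (λ j → sum (double (swapRows A) j)) ⟨
    sum (λ j → sum (double A j) + sum (double (swapRows A) j))
      ≈⟨ sum-cong-≋ (λ j → sym (∑-distrib-+ (double A j) (double (swapRows A) j))) ⟩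
    sum (λ j → sum (λ l → double A j l + double (swapRows A) j l))
      ≈⟨ sum-cancel (λ j l → double A j l + double (swapRows A) j l) cancel ⟩
    0# ∎
    where
    cancel : ∀ j l → j Fin.≤ l →
      double A (inject₁ j) l + double (swapRows A) (inject₁ j) l +
      (double A (suc l) j + double (swapRows A) (suc l) j) ≈ 0#
    cancel j l j≤l = begin
      a + b + (a′ + b′)
        ≈⟨ solve 4 (λ a b a′ b′ → a :+ b :+ (a′ :+ b′) := (a :+ b′) :+ (b :+ a′)) refl a b a′ b′ ⟩
      (a + b′) + (b + a′)
        ≈⟨ +-cong (double-swap A (swapRows A) (λ _ _ → refl) j l j≤l)
             (double-swap (swapRows A) A
               (λ { zero _ → refl ; (suc zero) _ → refl ; (suc (suc _)) _ → refl }) j l j≤l) ⟩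
      0# + 0#
        ≈⟨ +-identityˡ 0# ⟩
      0# ∎
      where
      a b a′ b′ : Carrier
      a  = double A (inject₁ j) l
      b  = double (swapRows A) (inject₁ j) l
      a′ = double A (suc l) j
      b′ = double (swapRows A) (suc l) j

  -- If rows 0 and 1 agree, the double expansion cancels in pairs; `det-swap` alone would only give
  -- 2 det A = 0. Otherwise swapping rows 0 and 1 moves the repeated row below the first, so all
  -- minors of the swapped matrix vanish by induction.
  det-alternating₀ : ∀ {k} (A : Matrix (suc k) (suc k)) j → A zero ≋ᵛ A (suc j) → det A ≈ 0#
  det-alternating₀ {suc k} A zero A₀≋A₁ = trans (det-double A)
    (sum-cancel (double A) (double-swap A A λ where
      zero          s → A₀≋A₁ s
      (suc zero)    s → sym (A₀≋A₁ s)
      (suc (suc _)) s → refl))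
  det-alternating₀ {suc k} A (suc j) A₀≋Aⱼ = begin
    det A                     ≈⟨ +-identityʳ _ ⟨
    det A + 0#                ≈⟨ +-congˡ (det-zero-minors (swapRows A) λ l →
      det-alternating₀ (minor (swapRows A) l) j λ s → A₀≋Aⱼ (punchIn l s)) ⟨
    det A + det (swapRows A)  ≈⟨ det-swap A ⟩
    0#                        ∎

  det-alternating : ∀ {k} (A : Matrix k k) {i j} → i ≢ j → A i ≋ᵛ A j → det A ≈ 0#
  det-alternating A {zero}  {zero}  i≢j _     = ⊥-elim (i≢j ≡.refl)
  det-alternating A {zero}  {suc j} _   Aᵢ≋Aⱼ = det-alternating₀ A j Aᵢ≋Aⱼ
  det-alternating A {suc i} {zero}  _   Aᵢ≋Aⱼ = det-alternating₀ A i λ s → sym (Aᵢ≋Aⱼ s)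
  det-alternating A {suc i} {suc j} i≢j Aᵢ≋Aⱼ = det-zero-minors A λ l →
    det-alternating (minor A l) (i≢j ∘ ≡.cong suc) λ s → Aᵢ≋Aⱼ (punchIn l s)

  -- Row operations

  replaceRow : ∀ {k l} → Matrix k l → Fin k → Vector Carrier l → Matrix k l
  replaceRow A i v = updateAt A i (const v)

  replaceRow-at : ∀ {k l} (A : Matrix k l) i v → replaceRow A i v i ≋ᵛ v
  replaceRow-at A i v s = reflexive (≡.cong (λ f → f s) (updateAt-updates i A))

  replaceRow-off : ∀ {k l} (A : Matrix k l) i v {r} → r ≢ i → replaceRow A i v r ≋ᵛ A r
  replaceRow-off A i v {r} r≢i s = reflexive (≡.cong (λ f → f s) (updateAt-minimal r i A r≢i))

  -- Linearity in row i splits off one summand at a time; each leaves a matrix with two equal rows.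
  det-dependent : ∀ {k l} (A : Matrix k k) i (ρ : Fin l → Fin k) (c : Vector Carrier l) →
                  (∀ j → ρ j ≢ i) → (∀ s → A i s ≈ sum λ j → c j * A (ρ j) s) → det A ≈ 0#
  det-dependent {l = zero} A i ρ c ρ≢i Aᵢ≈0 = x+x≈x⇒x≈0 (det A) (sym (begin
    -- A zero row equals 1 times itself plus itself, so linearity applies with all three matrices
    -- equal to `A`.
    det A               ≈⟨ det-linear i 1# {A} {A} {A} (λ _ _ _ → refl) (λ _ _ _ → refl)
                             (λ s → sym (trans (+-cong (*-identityˡ _) (Aᵢ≈0 s)) (+-identityʳ _))) ⟩
    1# * det A + det A  ≈⟨ +-congʳ (*-identityˡ (det A)) ⟩
    det A + det A       ∎))
  det-dependent {l = suc l} A i ρ c ρ≢i Aᵢ = begin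
    det A                       ≈⟨ det-linear i (c zero) {B} {C} {A}
                                     (λ r → replaceRow-off A i v) (λ r → replaceRow-off A i w)
                                     (λ s → trans (Aᵢ s) (sym (+-cong
                                       (*-congˡ (replaceRow-at A i v s)) (replaceRow-at A i w s)))) ⟩
    c zero * det B + det C      ≈⟨ +-cong (*-congˡ det-B) det-C ⟩
    c zero * 0# + 0#            ≈⟨ +-identityʳ _ ⟩
    c zero * 0#                 ≈⟨ zeroʳ (c zero) ⟩
    0#                          ∎
    where
    v w : Vector Carrier _
    v = A (ρ zero)
    w s = sum λ j → c (suc j) * A (ρ (suc j)) s
    B C : Matrix _ _
    B = replaceRow A i v
    C = replaceRow A i w
    det-B : det B ≈ 0#
    det-B = det-alternating B (ρ≢i zero) λ s →
      trans (replaceRow-off A i v (ρ≢i zero) s) (sym (replaceRow-at A i v s))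
    det-C : det C ≈ 0#
    det-C = det-dependent C i (ρ ∘ suc) (c ∘ suc) (ρ≢i ∘ suc) λ s →
      trans (replaceRow-at A i w s)
        (sum-cong-≋ λ j → *-congˡ (sym (replaceRow-off A i w (ρ≢i (suc j)) s)))

  det-addRows : ∀ {k l} {A B : Matrix k k} i (ρ : Fin l → Fin k) x (c : Vector Carrier l) →
                (∀ j → ρ j ≢ i) → (∀ r → r ≢ i → A r ≋ᵛ B r) →
                (∀ s → B i s ≈ x * A i s + sum λ j → c j * A (ρ j) s) → det B ≈ x * det A
  det-addRows {A = A} {B} i ρ x c ρ≢i A≋B Bᵢ = begin
    det B              ≈⟨ det-linear i x {A} {C} {B} A≋B
                            (λ r r≢i s → trans (replaceRow-off A i v r≢i s) (A≋B r r≢i s))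
                            (λ s → trans (Bᵢ s) (+-congˡ (sym (replaceRow-at A i v s)))) ⟩
    x * det A + det C  ≈⟨ +-congˡ (det-dependent C i ρ c ρ≢i λ s → trans (replaceRow-at A i v s)
                            (sum-cong-≋ λ j → *-congˡ (sym (replaceRow-off A i v (ρ≢i j) s)))) ⟩
    x * det A + 0#     ≈⟨ +-identityʳ _ ⟩
    x * det A          ∎
    where
    v : Vector Carrier _
    v s = sum λ j → c j * A (ρ j) s
    C : Matrix _ _
    C = replaceRow A i v

  -- The rows `ρ j` that are added lie outside the rows `ι i` that change, so the changes can be
  -- undone one row at a time, each costing a factor `x`. With x = 1 this is plain row addition; x =
  -- q serves the elimination of the top rows of N.
  det-shear : ∀ {k p l} {A B : Matrix k k} (ι : Fin p → Fin k) (ρ : Fin l → Fin k) x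
              (c : Matrix p l) → (∀ {i j} → ι i ≡ ι j → i ≡ j) → (∀ i j → ρ j ≢ ι i) →
              (∀ r → (∀ i → r ≢ ι i) → A r ≋ᵛ B r) →
              (∀ i s → B (ι i) s ≈ x * A (ι i) s + sum λ j → c i j * A (ρ j) s) →
              det B ≈ x ^ p * det A
  det-shear {p = zero} {A = A} {B} ι ρ x c ι-inj ρ≢ι A≋B _ =
    trans (det-cong λ r s → sym (A≋B r (λ ()) s)) (sym (*-identityˡ (det A)))
  det-shear {p = suc p} {A = A} {B} ι ρ x c ι-inj ρ≢ι A≋B Bᵢ = begin
    det B                ≈⟨ det-addRows i₀ ρ x (c zero) (ρ≢ι zero)
                              (λ r → replaceRow-off B i₀ (A i₀))
                              (λ s → trans (Bᵢ zero s) (sym (+-cong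
                                (*-congˡ (replaceRow-at B i₀ (A i₀) s))
                                (sum-cong-≋ λ j → *-congˡ (trans
                                  (replaceRow-off B i₀ (A i₀) (ρ≢ι zero j) s)
                                  (sym (A≋B (ρ j) (λ i → ρ≢ι i j) s))))))) ⟩
    x * det C            ≈⟨ *-congˡ (det-shear (ι ∘ suc) ρ x (c ∘ suc)
                              (Fin.suc-injective ∘ ι-inj) (ρ≢ι ∘ suc) A≋C Cᵢ) ⟩
    x * (x ^ p * det A)  ≈⟨ *-assoc x (x ^ p) (det A) ⟨
    x ^ suc p * det A    ∎
    where
    i₀ : Fin _
    i₀ = ι zero
    C : Matrix _ _
    C = replaceRow B i₀ (A i₀)
    A≋C : ∀ r → (∀ i → r ≢ ι (suc i)) → A r ≋ᵛ C r
    A≋C r r≢ι s with r Fin.≟ i₀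
    ... | yes ≡.refl = sym (replaceRow-at B i₀ (A i₀) s)
    ... | no r≢i₀    = trans (A≋B r (λ { zero → r≢i₀ ; (suc i) → r≢ι i }) s)
      (sym (replaceRow-off B i₀ (A i₀) r≢i₀ s))
    Cᵢ : ∀ i s → C (ι (suc i)) s ≈ x * A (ι (suc i)) s + sum λ j → c (suc i) j * A (ρ j) s
    Cᵢ i s = trans
      (replaceRow-off B i₀ (A i₀) (λ eq → Fin.0≢1+n (≡.sym (ι-inj eq))) s) (Bᵢ (suc i) s)

  -- Block triangular determinants

  sum-split : ∀ k {l} (f : Vector Carrier (k ℕ.+ l)) →
              sum f ≈ sum (λ i → f (i ↑ˡ l)) + sum (λ j → f (k ↑ʳ j))
  sum-split zero    f = sym (+-identityˡ _)
  sum-split (suc k) f = trans (+-congˡ (sum-split k (f ∘ suc))) (sym (+-assoc _ _ _))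

  punchIn-↑ˡ-↑ˡ : ∀ {k} l (i : Fin (suc k)) j → punchIn (i ↑ˡ l) (j ↑ˡ l) ≡ punchIn i j ↑ˡ l
  punchIn-↑ˡ-↑ˡ l zero    j       = ≡.refl
  punchIn-↑ˡ-↑ˡ l (suc i) zero    = ≡.refl
  punchIn-↑ˡ-↑ˡ l (suc i) (suc j) = ≡.cong suc (punchIn-↑ˡ-↑ˡ l i j)

  punchIn-↑ˡ-↑ʳ : ∀ k {l} (i : Fin (suc k)) (j : Fin l) → punchIn (i ↑ˡ l) (k ↑ʳ j) ≡ suc k ↑ʳ j
  punchIn-↑ˡ-↑ʳ k       zero    j = ≡.refl
  punchIn-↑ˡ-↑ʳ (suc k) (suc i) j = ≡.cong suc (punchIn-↑ˡ-↑ʳ k i j)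

  -- In the first row only the columns of the left block contribute, and their minors are again
  -- block lower triangular with the same lower right block.
  det-lowerBlock : ∀ k {l} (A : Matrix (k ℕ.+ l) (k ℕ.+ l)) →
                   (∀ i j → A (i ↑ˡ l) (k ↑ʳ j) ≈ 0#) →
                   det A ≈ det (λ i j → A (i ↑ˡ l) (j ↑ˡ l)) * det (λ i j → A (k ↑ʳ i) (k ↑ʳ j))
  det-lowerBlock zero        A h = sym (*-identityˡ (det A))
  det-lowerBlock (suc k) {l} A h = begin
    det A
      ≈⟨ sum-split (suc k) (λ j → sign j * A zero j * det (minor A j)) ⟩
    sum (λ j → sign (j ↑ˡ l) * A zero (j ↑ˡ l) * det (minor A (j ↑ˡ l)))
      + sum (λ j → sign (suc k ↑ʳ j) * A zero (suc k ↑ʳ j) * det (minor A (suc k ↑ʳ j)))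
      ≈⟨ +-cong (sum-cong-≋ λ j → trans
             (*-cong (*-congʳ {A zero (j ↑ˡ l)} (reflexive (≡.cong ((- 1#) ^_) (Fin.toℕ-↑ˡ j l))))
               (minor-block j))
             (sym (*-assoc (sign j * A zero (j ↑ˡ l)) (det (minor P j)) (det Q))))
           (sum-zero {f = λ j → sign (suc k ↑ʳ j) * A zero (suc k ↑ʳ j) * det (minor A (suc k ↑ʳ j))}
             λ j → trans (*-congʳ (trans (*-congˡ (h zero j)) (zeroʳ _))) (zeroˡ _)) ⟩
    sum (λ j → sign j * P zero j * det (minor P j) * det Q) + 0#
      ≈⟨ +-identityʳ _ ⟩
    sum (λ j → sign j * P zero j * det (minor P j) * det Q)
      ≈⟨ *-distribʳ-sum (det Q) (λ j → sign j * P zero j * det (minor P j)) ⟨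
    det P * det Q ∎
    where
    P : Matrix (suc k) (suc k)
    P i j = A (i ↑ˡ l) (j ↑ˡ l)
    Q : Matrix l l
    Q i j = A (suc k ↑ʳ i) (suc k ↑ʳ j)
    minor-block : ∀ j → det (minor A (j ↑ˡ l)) ≈ det (minor P j) * det Q
    minor-block j = trans
      (det-lowerBlock k (minor A (j ↑ˡ l)) λ r s → trans
        (reflexive (≡.cong (A (suc r ↑ˡ l)) (punchIn-↑ˡ-↑ʳ k j s))) (h (suc r) s))
      (*-cong
        (det-cong λ r s → reflexive (≡.cong (A (suc r ↑ˡ l)) (punchIn-↑ˡ-↑ˡ l j s)))
        (det-cong λ r s → reflexive (≡.cong (A (suc k ↑ʳ r)) (punchIn-↑ˡ-↑ʳ k j s))))

  det-zeroColumn : ∀ {k} (A : Matrix (suc k) (suc k)) → (∀ r → A r zero ≈ 0#) → det A ≈ 0#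
  det-zeroColumn A h = sum-zero {f = λ j → sign j * A zero j * det (minor A j)} λ where
    zero            → trans (*-congʳ (trans (*-congˡ (h zero)) (zeroʳ _))) (zeroˡ _)
    -- Column 0 survives in this minor. The implicit `suc _` exposes the size of the minor as a
    -- successor, as the induction requires.
    j@(suc {suc _} _) → trans (*-congˡ (det-zeroColumn (minor A j) (h ∘ suc))) (zeroʳ _)

  det-firstColumn : ∀ {k} (A : Matrix (suc k) (suc k)) → (∀ r → A (suc r) zero ≈ 0#) →
                    det A ≈ A zero zero * det (minor A zero)
  det-firstColumn A h = begin
    1# * A zero zero * det (minor A zero) + sum tail
      ≈⟨ +-cong (*-congʳ (*-identityˡ (A zero zero))) (sum-zero {f = tail} tail≈0) ⟩
    A zero zero * det (minor A zero) + 0#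
      ≈⟨ +-identityʳ _ ⟩
    A zero zero * det (minor A zero) ∎
    where
    tail : Vector Carrier _
    tail j = sign (suc j) * A zero (suc j) * det (minor A (suc j))
    tail≈0 : ∀ j → tail j ≈ 0#
    -- The split on `j` serves only to show that the minor is nonempty.
    tail≈0 j@zero    = trans (*-congˡ (det-zeroColumn (minor A (suc j)) h)) (zeroʳ _)
    tail≈0 j@(suc _) = trans (*-congˡ (det-zeroColumn (minor A (suc j)) h)) (zeroʳ _)

  𝟙 : ∀ {k} → Fin k → Fin k → Carrier
  𝟙 i j = if does (i Fin.≟ j) then 1# else 0#

  -- The first column is a unit vector, so `det-firstColumn` peels off the identity block one factor
  -- 1 at a time.
  det-unitriangularBlock : ∀ k {l} (A : Matrix (k ℕ.+ l) (k ℕ.+ l)) →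
                           (∀ i j → A (i ↑ˡ l) (j ↑ˡ l) ≈ 𝟙 i j) →
                           (∀ i j → A (k ↑ʳ i) (j ↑ˡ l) ≈ 0#) →
                           det A ≈ det (λ i j → A (k ↑ʳ i) (k ↑ʳ j))
  det-unitriangularBlock zero        A _  _  = refl
  det-unitriangularBlock (suc k) {l} A h₁ h₀ = begin
    det A                             ≈⟨ det-firstColumn A
                                           (∀-+ k (λ i → h₁ (suc i) zero) (λ i → h₀ i zero)) ⟩
    A zero zero * det (minor A zero)  ≈⟨ *-cong (h₁ zero zero)
                                           (det-unitriangularBlock k (minor A zero)
                                             (λ i j → h₁ (suc i) (suc j)) (λ i j → h₀ i (suc j))) ⟩
    1# * det Q  ≈⟨ *-identityˡ _ ⟩
    det Q ∎
    where
    Q : Matrix l l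
    Q i j = A (suc k ↑ʳ i) (suc k ↑ʳ j)

  -- Scalar matrices and sums against the identity

  det-scalar : ∀ k x → det {k} (λ i j → x * 𝟙 i j) ≈ x ^ k
  det-scalar zero    x = refl
  det-scalar (suc k) x = trans
    (det-firstColumn {k} (λ i j → x * 𝟙 i j) (λ r → zeroʳ x))
    (*-cong (*-identityʳ x) (det-scalar k x))

  𝟙-refl : ∀ {k} (i : Fin k) → 𝟙 i i ≡ 1#
  𝟙-refl i = ≡.cong (if_then 1# else 0#) (dec-true (i Fin.≟ i) ≡.refl)

  𝟙-≢ : ∀ {k} {i j : Fin k} → i ≢ j → 𝟙 i j ≡ 0#
  𝟙-≢ {i = i} {j} i≢j = ≡.cong (if_then 1# else 0#) (dec-false (i Fin.≟ j) i≢j)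

  𝟙-injective : ∀ {k l} (f : Fin k → Fin l) → (∀ {i j} → f i ≡ f j → i ≡ j) →
                ∀ i j → 𝟙 (f i) (f j) ≡ 𝟙 i j
  𝟙-injective f f-inj i j with i Fin.≟ j
  ... | yes ≡.refl = 𝟙-refl (f i)
  ... | no i≢j     = 𝟙-≢ (i≢j ∘ f-inj)

  𝟙-sym : ∀ {k} (i j : Fin k) → 𝟙 i j ≡ 𝟙 j i
  𝟙-sym i j with i Fin.≟ j
  ... | yes ≡.refl = ≡.sym (𝟙-refl i)
  ... | no i≢j     = ≡.sym (𝟙-≢ (i≢j ∘ ≡.sym))

  sum-𝟙ˡ : ∀ {k} i (f : Vector Carrier k) → sum (λ j → 𝟙 i j * f j) ≈ f i
  sum-𝟙ˡ zero    f = trans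
    (+-cong (*-identityˡ (f zero)) (sum-zero {f = λ j → 0# * f (suc j)} λ j → zeroˡ (f (suc j))))
    (+-identityʳ (f zero))
  sum-𝟙ˡ (suc i) f = trans (+-cong (zeroˡ (f zero)) (sum-𝟙ˡ i (f ∘ suc))) (+-identityˡ (f (suc i)))

  sum-𝟙ʳ : ∀ {k} (f : Vector Carrier k) i → sum (λ j → f j * 𝟙 j i) ≈ f i
  sum-𝟙ʳ f i = trans
    (sum-cong-≋ λ j → trans (*-comm (f j) (𝟙 j i)) (*-congʳ (reflexive (𝟙-sym j i))))
    (sum-𝟙ˡ i f)

  1^k≈1 : ∀ k → 1# ^ k ≈ 1#
  1^k≈1 zero    = refl
  1^k≈1 (suc k) = trans (*-identityˡ (1# ^ k)) (1^k≈1 k)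

  det-𝟙 : ∀ k → det {k} 𝟙 ≈ 1#
  det-𝟙 k = trans (det-cong {k} {𝟙} λ i j → sym (*-identityˡ (𝟙 i j)))
    (trans (det-scalar k 1#) (1^k≈1 k))

  -- The matrices 𝟙 + w S

  sum-swapHalves : ∀ m (f : Vector Carrier (m ℕ.+ m)) → sum (f ∘ swapHalves m) ≈ sum f
  sum-swapHalves m f = begin
    sum (f ∘ swapHalves m)
      ≈⟨ sum-split m (f ∘ swapHalves m) ⟩
    sum (λ i → f (swapHalves m (i ↑ˡ m))) + sum (λ i → f (swapHalves m (m ↑ʳ i)))
      ≈⟨ +-cong (sum-cong-≋ λ i → reflexive (≡.cong f (swapHalves-↑ˡ m i)))
                (sum-cong-≋ λ i → reflexive (≡.cong f (swapHalves-↑ʳ m i))) ⟩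
    sum (λ i → f (m ↑ʳ i)) + sum (λ i → f (i ↑ˡ m))
      ≈⟨ +-comm _ _ ⟩
    sum (λ i → f (i ↑ˡ m)) + sum (λ i → f (m ↑ʳ i))
      ≈⟨ sum-split m f ⟨
    sum f ∎

  -- Here `w` will be - bu, the negative of the w of the overview, and `w′` will be bu. A separate
  -- variable for the negative keeps the identities free of negation and so within reach of the
  -- commutative semiring solver.
  module _ (m : ℕ) {w w′ q : Carrier} (w+w′≈0 : w + w′ ≈ 0#) (q≈1+ww′ : q ≈ 1# + w * w′) where

    -- 𝟙 + w S for the arc reversal S; its product with 𝟙 + w′ S is q 𝟙.
    reflection : Matrix (m ℕ.+ m) (m ℕ.+ m)
    reflection i j = 𝟙 i j + w * 𝟙 (swapHalves m i) j

    private
      -- The entrywise form of (𝟙 + w′ S)(𝟙 + w S) = q 𝟙, where `y` and `z` are entries at mutually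
      -- reversed positions; the cross terms cancel because w + w′ = 0.
      absorb : ∀ y z → q * y ≈ (y + w′ * z) + w * (z + w′ * y)
      absorb y z = begin
        q * y                            ≈⟨ *-congʳ q≈1+ww′ ⟩
        (1# + w * w′) * y                ≈⟨ +-identityʳ _ ⟨
        (1# + w * w′) * y + 0#           ≈⟨ +-congˡ (trans (*-congʳ w+w′≈0) (zeroˡ z)) ⟨
        (1# + w * w′) * y + (w + w′) * z ≈⟨ +-congʳ (trans (distribʳ y 1# (w * w′))
                                              (+-congʳ (*-identityˡ y))) ⟩
        y + w * w′ * y + (w + w′) * z
          ≈⟨ solve 4 (λ w w′ y z → y :+ w :* w′ :* y :+ (w :+ w′) :* z :=
                 (y :+ w′ :* z) :+ w :* (z :+ w′ :* y)) refl w w′ y z ⟩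
        (y + w′ * z) + w * (z + w′ * y)  ∎

    -- In m × m blocks the matrix has 𝟙 on the diagonal and w 𝟙 off it. Adding w′ times the bottom
    -- rows to the top rows makes it block lower triangular with diagonal blocks q 𝟙 and 𝟙.
    det-reflection : det reflection ≈ q ^ m
    det-reflection = begin
      det reflection           ≈⟨ *-identityˡ _ ⟨
      1# * det reflection      ≈⟨ *-congʳ (1^k≈1 m) ⟨
      1# ^ m * det reflection  ≈⟨ det-shear (_↑ˡ m) (m ↑ʳ_) 1# (λ i j → w′ * 𝟙 i j)
                                    (Fin.↑ˡ-injective m _ _) (λ i j → ↑ˡ≢↑ʳ m i j ∘ ≡.sym)
                                    (∀-+ m (λ i i≢ → ⊥-elim (i≢ i ≡.refl))
                                      (λ j _ s → reflexive (≡.cong (λ f → f s)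
                                        (≡.sym (lookup-++ʳ top bottom j)))))
                                    topRows ⟨
      det (top ++ bottom)      ≈⟨ det-lowerBlock m (top ++ bottom) (λ i j → trans
                                    (reflexive (≡.cong (λ f → f (m ↑ʳ j)) (lookup-++ˡ top bottom i)))
                                    (trans (*-congˡ (reflexive (𝟙-≢ (↑ˡ≢↑ʳ m i j)))) (zeroʳ q))) ⟩
      det (λ i j → (top ++ bottom) (i ↑ˡ m) (j ↑ˡ m))
        * det (λ i j → (top ++ bottom) (m ↑ʳ i) (m ↑ʳ j))
        ≈⟨ *-cong
             (trans (det-cong λ i j → trans
                 (reflexive (≡.cong (λ f → f (j ↑ˡ m)) (lookup-++ˡ top bottom i)))
                 (*-congˡ (reflexive (𝟙-injective (_↑ˡ m) (Fin.↑ˡ-injective m _ _) i j))))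
               (det-scalar m q))
             (trans (det-cong λ i j → trans
                 (reflexive (≡.cong (λ f → f (m ↑ʳ j)) (lookup-++ʳ top bottom i)))
                 (trans (+-cong (reflexive (𝟙-injective (m ↑ʳ_) (Fin.↑ʳ-injective m _ _) i j))
                     (trans (*-congˡ (reflexive (≡.trans
                         (≡.cong (λ k → 𝟙 k (m ↑ʳ j)) (swapHalves-↑ʳ m i)) (𝟙-≢ (↑ˡ≢↑ʳ m i j)))))
                       (zeroʳ w)))
                   (+-identityʳ (𝟙 i j))))
               (det-𝟙 m)) ⟩
      q ^ m * 1#  ≈⟨ *-identityʳ _ ⟩
      q ^ m       ∎
      where
      top bottom : Matrix m (m ℕ.+ m)
      top i s = q * 𝟙 (i ↑ˡ m) s
      bottom i = reflection (m ↑ʳ i)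
      topRows : ∀ i s → (top ++ bottom) (i ↑ˡ m) s ≈
                1# * reflection (i ↑ˡ m) s + sum λ j → w′ * 𝟙 i j * reflection (m ↑ʳ j) s
      topRows i s = begin
        (top ++ bottom) (i ↑ˡ m) s
          ≡⟨ ≡.cong (λ f → f s) (lookup-++ˡ top bottom i) ⟩
        q * y
          ≈⟨ absorb y z ⟩
        (y + w′ * z) + w * (z + w′ * y)
          -- Regrouped into the entries of `reflection` in rows i and m + i, which are `y + w * z`
          -- and `z + w * y`.
          ≈⟨ solve 4 (λ w w′ y z → (y :+ w′ :* z) :+ w :* (z :+ w′ :* y) :=
                 (y :+ w :* z) :+ w′ :* (z :+ w :* y)) refl w w′ y z ⟩
        (y + w * z) + w′ * (z + w * y)
          ≈⟨ +-cong (trans (*-identityˡ _) (+-congˡ (*-congˡ (reflexive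
                      (≡.cong (λ k → 𝟙 k s) (swapHalves-↑ˡ m i))))))
                    (*-congˡ (trans (sum-𝟙ˡ i (λ j → reflection (m ↑ʳ j) s))
                      (+-congˡ (*-congˡ (reflexive (≡.cong (λ k → 𝟙 k s) (swapHalves-↑ʳ m i))))))) ⟨
        1# * reflection (i ↑ˡ m) s + w′ * sum (λ j → 𝟙 i j * reflection (m ↑ʳ j) s)
          ≈⟨ +-congˡ (trans (*-distribˡ-sum w′ (λ j → 𝟙 i j * reflection (m ↑ʳ j) s))
               (sum-cong-≋ λ j → sym (*-assoc w′ (𝟙 i j) (reflection (m ↑ʳ j) s)))) ⟩
        1# * reflection (i ↑ˡ m) s + sum (λ j → w′ * 𝟙 i j * reflection (m ↑ʳ j) s) ∎
        where
        y z : Carrier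
        y = 𝟙 (i ↑ˡ m) s
        z = 𝟙 (m ↑ʳ i) s

    sum-reflection : ∀ (E : Vector Carrier (m ℕ.+ m)) j →
                     sum (λ k → E k * reflection k j) ≈ E j + w * E (swapHalves m j)
    sum-reflection E j = begin
      sum (λ k → E k * reflection k j)
        ≈⟨ sum-cong-≋ (λ k → solve 4 (λ e d w d′ → e :* (d :+ w :* d′) := e :* d :+ w :* (e :* d′))
             refl (E k) (𝟙 k j) w (𝟙 (σ k) j)) ⟩
      sum (λ k → E k * 𝟙 k j + w * (E k * 𝟙 (σ k) j))
        ≈⟨ ∑-distrib-+ (λ k → E k * 𝟙 k j) (λ k → w * (E k * 𝟙 (σ k) j)) ⟩
      sum (λ k → E k * 𝟙 k j) + sum (λ k → w * (E k * 𝟙 (σ k) j))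
        ≈⟨ +-cong (sum-𝟙ʳ E j) (sym (*-distribˡ-sum w (λ k → E k * 𝟙 (σ k) j))) ⟩
      E j + w * sum (λ k → E k * 𝟙 (σ k) j)
        -- With `E k` written as `E (σ (σ k))`, the summand depends on `σ k` alone and the sum can
        -- be reindexed.
        ≈⟨ +-congˡ (*-congˡ (sum-cong-≋ λ k →
             *-congʳ {𝟙 (σ k) j} (reflexive (≡.cong E (≡.sym (swapHalves-involutive m k)))))) ⟩
      E j + w * sum (λ k → E (σ (σ k)) * 𝟙 (σ k) j)
        ≈⟨ +-congˡ (*-congˡ (sum-swapHalves m (λ k → E (σ k) * 𝟙 k j))) ⟩
      E j + w * sum (λ k → E (σ k) * 𝟙 k j)
        ≈⟨ +-congˡ (*-congˡ (sum-𝟙ʳ (E ∘ σ) j)) ⟩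
      E j + w * E (σ j) ∎
      where
      σ : Fin (m ℕ.+ m) → Fin (m ℕ.+ m)
      σ = swapHalves m

    -- Two eliminations in the block matrix N

    module _ {n} (Y : Matrix n (m ℕ.+ m)) (X : Matrix (m ℕ.+ m) n) where

      private
        p : ℕ
        p = m ℕ.+ m

        σ : Fin p → Fin p
        σ = swapHalves m

        top : Matrix n (n ℕ.+ p)
        top v = 𝟙 v ++ Y v

        bottom : Matrix p (n ℕ.+ p)
        bottom i = (λ v → - X i v) ++ reflection i

        N : Matrix (n ℕ.+ p) (n ℕ.+ p)
        N = top ++ bottom

        N-top : ∀ v s → N (v ↑ˡ p) s ≡ top v s
        N-top v s = ≡.cong (λ f → f s) (lookup-++ˡ top bottom v)

        N-bottom : ∀ i s → N (n ↑ʳ i) s ≡ bottom i s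
        N-bottom i s = ≡.cong (λ f → f s) (lookup-++ʳ top bottom i)

      -- The Schur complement of the identity block in N, whose lower left block is - X.
      sylvesterˡ : Matrix p p
      sylvesterˡ i j = reflection i j + sum λ v → X i v * Y v j

      -- The matrix q 𝟙 + Y (𝟙 + w′ S) X. For invertible q it is q times the Schur complement of
      -- `reflection` in N, since (𝟙 + w′ S) / q is then the inverse of `reflection`.
      sylvesterʳ : Matrix n n
      sylvesterʳ u v = q * 𝟙 u v + sum λ k → (Y u k + w′ * Y u (σ k)) * X k v

      -- Adding X times the top rows (𝟙, Y) to the bottom rows clears - X and leaves a block upper
      -- triangular matrix.
      det-eliminateBottom : det sylvesterˡ ≈ det N
      det-eliminateBottom = begin
        det sylvesterˡ
          ≈⟨ det-cong (λ i j → reflexive (≡.sym (≡.trans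
               (≡.cong (λ f → f (n ↑ʳ j)) (lookup-++ʳ top bottom′ i))
               (lookup-++ʳ zeros (sylvesterˡ i) j)))) ⟩
        det (λ i j → (top ++ bottom′) (n ↑ʳ i) (n ↑ʳ j))
          ≈⟨ det-unitriangularBlock n (top ++ bottom′)
               (λ u v → reflexive (≡.trans
                 (≡.cong (λ f → f (v ↑ˡ p)) (lookup-++ˡ top bottom′ u)) (lookup-++ˡ (𝟙 u) (Y u) v)))
               (λ i v → reflexive (≡.trans
                 (≡.cong (λ f → f (v ↑ˡ p)) (lookup-++ʳ top bottom′ i))
                 (lookup-++ˡ zeros (sylvesterˡ i) v))) ⟨
        det (top ++ bottom′)
          ≈⟨ det-shear (n ↑ʳ_) (_↑ˡ p) 1# X (Fin.↑ʳ-injective n _ _)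
               (λ i v → ↑ˡ≢↑ʳ n v i)
               (∀-+ n (λ v _ s → reflexive (≡.trans (N-top v s)
                   (≡.cong (λ f → f s) (≡.sym (lookup-++ˡ top bottom′ v)))))
                 (λ i i≢ → ⊥-elim (i≢ i ≡.refl)))
               (λ i → ∀-+ n (left i) (right i)) ⟩
        1# ^ p * det N
          ≈⟨ *-congʳ (1^k≈1 p) ⟩
        1# * det N
          ≈⟨ *-identityˡ _ ⟩
        det N ∎
        where
        zeros : Vector Carrier n
        zeros _ = 0#
        bottom′ : Matrix p (n ℕ.+ p)
        bottom′ i = zeros ++ sylvesterˡ i
        left : ∀ i v → (top ++ bottom′) (n ↑ʳ i) (v ↑ˡ p) ≈
               1# * N (n ↑ʳ i) (v ↑ˡ p) + sum λ u → X i u * N (u ↑ˡ p) (v ↑ˡ p)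
        left i v = begin
          (top ++ bottom′) (n ↑ʳ i) (v ↑ˡ p)
            ≡⟨ ≡.trans (≡.cong (λ f → f (v ↑ˡ p)) (lookup-++ʳ top bottom′ i))
                 (lookup-++ˡ zeros (sylvesterˡ i) v) ⟩
          0#
            ≈⟨ -‿inverseˡ (X i v) ⟨
          - X i v + X i v
            ≈⟨ +-cong (trans (*-identityˡ _) (reflexive (≡.trans (N-bottom i _)
                   (lookup-++ˡ (λ v → - X i v) (reflection i) v))))
                 (trans (sum-cong-≋ λ u → *-congˡ (reflexive (≡.trans (N-top u _)
                     (lookup-++ˡ (𝟙 u) (Y u) v)))) (sum-𝟙ʳ (X i) v)) ⟨
          1# * N (n ↑ʳ i) (v ↑ˡ p) + sum (λ u → X i u * N (u ↑ˡ p) (v ↑ˡ p)) ∎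
        right : ∀ i j → (top ++ bottom′) (n ↑ʳ i) (n ↑ʳ j) ≈
                1# * N (n ↑ʳ i) (n ↑ʳ j) + sum λ u → X i u * N (u ↑ˡ p) (n ↑ʳ j)
        right i j = begin
          (top ++ bottom′) (n ↑ʳ i) (n ↑ʳ j)
            ≡⟨ ≡.trans (≡.cong (λ f → f (n ↑ʳ j)) (lookup-++ʳ top bottom′ i))
                 (lookup-++ʳ zeros (sylvesterˡ i) j) ⟩
          reflection i j + sum (λ u → X i u * Y u j)
            ≈⟨ +-cong (trans (*-identityˡ _) (reflexive (≡.trans (N-bottom i _)
                   (lookup-++ʳ (λ v → - X i v) (reflection i) j))))
                 (sum-cong-≋ λ u → *-congˡ (reflexive (≡.trans (N-top u _)
                   (lookup-++ʳ (𝟙 u) (Y u) j)))) ⟨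
          1# * N (n ↑ʳ i) (n ↑ʳ j) + sum (λ u → X i u * N (u ↑ˡ p) (n ↑ʳ j)) ∎

      -- Scaling the n top rows by q gives the factor qⁿ. Subtracting D = Y (𝟙 + w′ S) times the
      -- bottom rows then clears the upper right block, and the lower right block contributes
      -- `det reflection`, that is qᵐ.
      det-eliminateTop : det sylvesterʳ * q ^ m ≈ q ^ n * det N
      det-eliminateTop = begin
        det sylvesterʳ * q ^ m
          ≈⟨ *-cong (det-cong {n} top′-left) (trans (det-cong {p} bottom-right) det-reflection) ⟨
        det {n} (λ u v → (top′ ++ bottom) (u ↑ˡ p) (v ↑ˡ p))
          * det (λ i j → (top′ ++ bottom) (n ↑ʳ i) (n ↑ʳ j))
          ≈⟨ det-lowerBlock n (top′ ++ bottom) top′-right ⟨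
        det (top′ ++ bottom)
          ≈⟨ det-shear (_↑ˡ p) (n ↑ʳ_) q (λ u k → - D u k) (Fin.↑ˡ-injective p _ _)
               (λ v i → ↑ˡ≢↑ʳ n v i ∘ ≡.sym)
               (∀-+ n (λ v v≢ → ⊥-elim (v≢ v ≡.refl))
                 (λ i _ s → reflexive (≡.trans (N-bottom i s)
                   (≡.cong (λ f → f s) (≡.sym (lookup-++ʳ top′ bottom i))))))
               (λ u → ∀-+ n (left u) (right u)) ⟩
        q ^ n * det N ∎
        where
        D : Matrix n p
        D u k = Y u k + w′ * Y u (σ k)
        zeros : Vector Carrier p
        zeros _ = 0#
        top′ : Matrix n (n ℕ.+ p)
        top′ u = sylvesterʳ u ++ zeros
        top′-left : ∀ u v → (top′ ++ bottom) (u ↑ˡ p) (v ↑ˡ p) ≈ sylvesterʳ u v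
        top′-left u v = reflexive (≡.trans
          (≡.cong (λ f → f (v ↑ˡ p)) (lookup-++ˡ top′ bottom u)) (lookup-++ˡ (sylvesterʳ u) zeros v))
        top′-right : ∀ u j → (top′ ++ bottom) (u ↑ˡ p) (n ↑ʳ j) ≈ 0#
        top′-right u j = reflexive (≡.trans
          (≡.cong (λ f → f (n ↑ʳ j)) (lookup-++ˡ top′ bottom u)) (lookup-++ʳ (sylvesterʳ u) zeros j))
        bottom-right : ∀ i j → (top′ ++ bottom) (n ↑ʳ i) (n ↑ʳ j) ≈ reflection i j
        bottom-right i j = reflexive (≡.trans
          (≡.cong (λ f → f (n ↑ʳ j)) (lookup-++ʳ top′ bottom i))
          (lookup-++ʳ (λ v → - X i v) (reflection i) j))
        left : ∀ u v → (top′ ++ bottom) (u ↑ˡ p) (v ↑ˡ p) ≈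
               q * N (u ↑ˡ p) (v ↑ˡ p) + sum λ k → - D u k * N (n ↑ʳ k) (v ↑ˡ p)
        left u v = begin
          (top′ ++ bottom) (u ↑ˡ p) (v ↑ˡ p)
            ≈⟨ top′-left u v ⟩
          q * 𝟙 u v + sum (λ k → D u k * X k v)
            ≈⟨ +-cong (*-congˡ (reflexive (≡.trans (N-top u _) (lookup-++ˡ (𝟙 u) (Y u) v))))
                 (sum-cong-≋ λ k → trans (*-congˡ (reflexive (≡.trans (N-bottom k _)
                   (lookup-++ˡ (λ v → - X k v) (reflection k) v)))) (-x*-y≈x*y (D u k) (X k v))) ⟨
          q * N (u ↑ˡ p) (v ↑ˡ p) + sum (λ k → - D u k * N (n ↑ʳ k) (v ↑ˡ p)) ∎
          where
          -x*-y≈x*y : ∀ x y → - x * - y ≈ x * y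
          -x*-y≈x*y x y = begin
            - x * - y    ≈⟨ -‿distribˡ-* x (- y) ⟨
            - (x * - y)  ≈⟨ -‿cong (-‿distribʳ-* x y) ⟨
            - - (x * y)  ≈⟨ -‿involutive (x * y) ⟩
            x * y        ∎
        right : ∀ u j → (top′ ++ bottom) (u ↑ˡ p) (n ↑ʳ j) ≈
                q * N (u ↑ˡ p) (n ↑ʳ j) + sum λ k → - D u k * N (n ↑ʳ k) (n ↑ʳ j)
        right u j = begin
          (top′ ++ bottom) (u ↑ˡ p) (n ↑ʳ j)
            ≈⟨ top′-right u j ⟩
          0#
            ≈⟨ -‿inverseʳ (q * Y u j) ⟨
          q * Y u j - q * Y u j
            -- This is the entry form of q Y = D (𝟙 + w S); the bracket becomes `D u (σ j)` because
            -- σ is an involution.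
            ≈⟨ +-congˡ (-‿cong (absorb (Y u j) (Y u (σ j)))) ⟩
          q * Y u j - (D u j + w * (Y u (σ j) + w′ * Y u j))
            ≈⟨ +-congˡ (-‿cong (+-congˡ (*-congˡ (+-congˡ (*-congˡ (reflexive
                 (≡.cong (Y u) (≡.sym (swapHalves-involutive m j))))))))) ⟩
          q * Y u j - (D u j + w * D u (σ j))
            ≈⟨ +-congˡ (trans (+-congˡ (sym (-‿distribʳ-* w (D u (σ j)))))
                 (-‿+-comm (D u j) (w * D u (σ j)))) ⟨
          q * Y u j + (- D u j + w * - D u (σ j))
            ≈⟨ +-cong (*-congˡ (reflexive (≡.trans (N-top u _) (lookup-++ʳ (𝟙 u) (Y u) j))))
                 (trans (sum-cong-≋ λ k → *-congˡ (reflexive (≡.trans (N-bottom k _)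
                   (lookup-++ʳ (λ v → - X k v) (reflection k) j))))
                   (sum-reflection (λ k → - D u k) j)) ⟨
          q * N (u ↑ˡ p) (n ↑ʳ j) + sum (λ k → - D u k * N (n ↑ʳ k) (n ↑ʳ j)) ∎

      det-sylvester : q ^ n * det sylvesterˡ ≈ q ^ m * det sylvesterʳ
      det-sylvester = begin
        q ^ n * det sylvesterˡ  ≈⟨ *-congˡ det-eliminateBottom ⟩
        q ^ n * det N           ≈⟨ det-eliminateTop ⟨
        det sylvesterʳ * q ^ m  ≈⟨ *-comm _ _ ⟩
        q ^ m * det sylvesterʳ  ∎

  -- Cancelling an invertible factor

  module _ {q v : Carrier} (qv≈1 : q * v ≈ 1#) where

    cancel-invertible : ∀ {x y} → q * x ≈ q * y → x ≈ y
    cancel-invertible {x} {y} qx≈qy = begin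
      x            ≈⟨ *-identityˡ x ⟨
      1# * x       ≈⟨ *-congʳ qv≈1 ⟨
      q * v * x    ≈⟨ *-congʳ (*-comm q v) ⟩
      v * q * x    ≈⟨ *-assoc v q x ⟩
      v * (q * x)  ≈⟨ *-congˡ qx≈qy ⟩
      v * (q * y)  ≈⟨ *-assoc v q y ⟨
      v * q * y    ≈⟨ *-congʳ (*-comm q v) ⟨
      q * v * y    ≈⟨ *-congʳ qv≈1 ⟩
      1# * y       ≈⟨ *-identityˡ y ⟩
      y            ∎

    cancel-power : ∀ k {x y} → q ^ k * x ≈ y → x ≈ v ^ k * y
    cancel-power zero    {x} {y} h = trans (sym (*-identityˡ x)) (trans h (sym (*-identityˡ y)))
    cancel-power (suc k) {x} {y} h = cancel-invertible (begin
      q * x                ≈⟨ cancel-power k (trans (solve 3 (λ q p x → p :* (q :* x) := q :* p :* x)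
                                refl q (q ^ k) x) h) ⟩
      v ^ k * y            ≈⟨ *-identityˡ _ ⟨
      1# * (v ^ k * y)     ≈⟨ *-congʳ qv≈1 ⟨
      q * v * (v ^ k * y)  ≈⟨ solve 4 (λ q v p y → q :* v :* (p :* y) := q :* (v :* p :* y))
                                refl q v (v ^ k) y ⟩
      q * (v ^ suc k * y)  ∎)

  -- Entries of the arc and vertex matrices

  -- Supplies the condition q = 1 + w w′ for w = - ub and w′ = ub.
  det-base : ∀ b u → 1# - b ^ 2 * u ^ 2 ≈ 1# + - (u * b) * (u * b)
  det-base b u = +-congˡ (trans
    (-‿cong (solve 2 (λ b u → b :^ 2 :* u :^ 2 := (u :* b) :* (u :* b)) refl b u))
    (-‿distribˡ-* (u * b) (u * b)))

  -- Opaque, because comparing the matrix entries over ℂ by unfolding the operations down to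
  -- rational sequences is not feasible.
  opaque
    -- An entry of I - uU, where D, E and P are the corresponding entries of I, S and S d* d.
    walkForm : (a b u D E P : Carrier) → Carrier
    walkForm a b u D E P = D - u * (a * P + b * (E - P))

    scaledDifference : (x y D E : Carrier) → Carrier
    scaledDifference x y D E = x * D - y * E

    scaledDifference-cong : ∀ {x y D D′ E E′} → D ≈ D′ → E ≈ E′ →
                            scaledDifference x y D E ≈ scaledDifference x y D′ E′
    scaledDifference-cong D≈D′ E≈E′ = +-cong (*-congˡ D≈D′) (-‿cong (*-congˡ E≈E′))

    walkForm-expand : ∀ a b u D E P →
      walkForm a b u D E P ≈ D + - (u * b) * E + - ((a - b) * u) * P
    walkForm-expand a b u D E P = begin
      D - u * (a * P + b * (E - P))
        -- Writing a as γ + b leaves - P as the only negation in the inner expression; the solver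
        -- treats it as a variable `N`.
        ≈⟨ +-congˡ (-‿cong (*-congˡ (+-congʳ (*-congʳ (//-rightDividesˡ b a))))) ⟨
      D - u * ((γ + b) * P + b * (E - P))
        ≈⟨ +-congˡ (-‿cong (solve 6 (λ u γ b P E N → u :* ((γ :+ b) :* P :+ b :* (E :+ N)) :=
               u :* b :* (E :+ N :+ P) :+ γ :* u :* P) refl u γ b P E (- P))) ⟩
      D - (u * b * (E - P + P) + γ * u * P)
        ≈⟨ +-congˡ (-‿cong (+-congʳ (*-congˡ (//-rightDividesˡ P E)))) ⟩
      D - (u * b * E + γ * u * P)
        ≈⟨ +-congˡ (-‿+-comm (u * b * E) (γ * u * P)) ⟨
      D + (- (u * b * E) + - (γ * u * P))
        ≈⟨ +-assoc D (- (u * b * E)) (- (γ * u * P)) ⟨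
      D + - (u * b * E) + - (γ * u * P)
        ≈⟨ +-cong (+-congˡ (-‿distribˡ-* (u * b) E)) (-‿distribˡ-* (γ * u) P) ⟩
      D + - (u * b) * E + - (γ * u) * P ∎
      where
      γ : Carrier
      γ = a - b

    -- Since ab = (a - b) b + b², the coefficient 1 - abu² splits into q and a remainder - cu · bu,
    -- which joins the term in G.
    scaledDifference-expand : ∀ a b u E G →
      scaledDifference (1# - a * b * u ^ 2) ((a - b) * u) E G ≈
      (1# - b ^ 2 * u ^ 2) * E + - ((a - b) * u) * (G + u * b * E)
    scaledDifference-expand a b u E G = begin
      (1# - a * b * u ^ 2) * E - γ * u * G
        ≈⟨ +-congʳ (expand (a * b * u ^ 2)) ⟩
      E - a * b * u ^ 2 * E - γ * u * G
        ≈⟨ collect (a * b * u ^ 2 * E) (γ * u * G) ⟩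
      E - (a * b * u ^ 2 * E + γ * u * G)
        ≈⟨ +-congˡ (-‿cong (+-congʳ (*-congʳ (*-congʳ (*-congʳ (//-rightDividesˡ b a)))))) ⟨
      E - ((γ + b) * b * u ^ 2 * E + γ * u * G)
        ≈⟨ +-congˡ (-‿cong (solve 5 (λ b γ u E G →
               (γ :+ b) :* b :* u :^ 2 :* E :+ γ :* u :* G :=
               b :^ 2 :* u :^ 2 :* E :+ γ :* u :* (G :+ u :* b :* E)) refl b γ u E G)) ⟩
      E - (b ^ 2 * u ^ 2 * E + γ * u * (G + u * b * E))
        ≈⟨ collect (b ^ 2 * u ^ 2 * E) (γ * u * (G + u * b * E)) ⟨
      E - b ^ 2 * u ^ 2 * E - γ * u * (G + u * b * E)
        ≈⟨ +-cong (sym (expand (b ^ 2 * u ^ 2))) (-‿distribˡ-* (γ * u) (G + u * b * E)) ⟩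
      (1# - b ^ 2 * u ^ 2) * E + - (γ * u) * (G + u * b * E) ∎
      where
      γ : Carrier
      γ = a - b
      expand : ∀ x → (1# - x) * E ≈ E - x * E
      expand x = trans ([y-z]x≈yx-zx E 1# x) (+-congʳ (*-identityˡ E))
      collect : ∀ x y → E - x - y ≈ E - (x + y)
      collect x y = trans (+-assoc E (- x) (- y)) (+-congˡ (-‿+-comm x y))

  -- Y is the matrix of d and Y* that of its adjoint; both matrices are written as they come
  -- out when the operators are applied to basis vectors.
  module _ m {n} (a b u : Carrier) (Y : Matrix n (m ℕ.+ m)) (Y* : Matrix (m ℕ.+ m) n) where

    arcMatrix : Matrix (m ℕ.+ m) (m ℕ.+ m)
    arcMatrix i j = walkForm a b u (𝟙 j i) (𝟙 j (swapHalves m i))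
      (sum λ v → Y v j * Y* (swapHalves m i) v)

    vertexMatrix : Matrix n n
    vertexMatrix i j = scaledDifference (1# - a * b * u ^ 2) ((a - b) * u) (𝟙 j i)
      (sum λ k → sum (λ v → 𝟙 j v * Y* (swapHalves m k) v) * Y i k)

  module _ m {n} (a b u : Carrier) (Y : Matrix n (m ℕ.+ m)) (Y* : Matrix (m ℕ.+ m) n)
           (YY*≈𝟙 : ∀ i j → sum (λ k → sum (λ v → 𝟙 j v * Y* k v) * Y i k) ≈ 𝟙 j i) where

    private
      σ : Fin (m ℕ.+ m) → Fin (m ℕ.+ m)
      σ = swapHalves m

      q t : Carrier
      q = 1# - b ^ 2 * u ^ 2
      t = (a - b) * u

      -- The negative of the lower left block cu SY* of N.
      X : Matrix (m ℕ.+ m) n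
      X i v = - t * Y* (σ i) v

      L : Matrix (m ℕ.+ m) (m ℕ.+ m)
      L = sylvesterˡ m (-‿inverseˡ (u * b)) (det-base b u) Y X

      Z : Matrix n n
      Z = sylvesterʳ m (-‿inverseˡ (u * b)) (det-base b u) Y X

      -- As S² = I, the product of YS and SY* is YY*; here dd* = I enters the computation.
      sum-YY* : ∀ i j → sum (λ k → Y i (σ k) * Y* (σ k) j) ≈ 𝟙 i j
      sum-YY* i j = begin
        sum (λ k → Y i (σ k) * Y* (σ k) j)
          ≈⟨ sum-swapHalves m (λ k → Y i k * Y* k j) ⟩
        sum (λ k → Y i k * Y* k j)
          ≈⟨ sum-cong-≋ (λ k → trans (*-comm (Y i k) (Y* k j))
               (*-congʳ (sym (sum-𝟙ˡ j (Y* k))))) ⟩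
        sum (λ k → sum (λ v → 𝟙 j v * Y* k v) * Y i k)
          ≈⟨ YY*≈𝟙 i j ⟩
        𝟙 j i
          ≡⟨ 𝟙-sym j i ⟩
        𝟙 i j ∎

    arcMatrix≋L : ∀ i j → arcMatrix m a b u Y Y* i j ≈ L i j
    arcMatrix≋L i j = begin
      arcMatrix m a b u Y Y* i j
        ≈⟨ walkForm-expand a b u (𝟙 j i) (𝟙 j (σ i)) P ⟩
      𝟙 j i + - (u * b) * 𝟙 j (σ i) + - t * P
        ≈⟨ +-cong (+-cong (reflexive (𝟙-sym j i)) (*-congˡ (reflexive (𝟙-sym j (σ i)))))
             (trans (*-distribˡ-sum (- t) (λ v → Y v j * Y* (σ i) v))
               (sum-cong-≋ λ v → solve 3 (λ t y z → t :* (y :* z) := t :* z :* y)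
                 refl (- t) (Y v j) (Y* (σ i) v))) ⟩
      L i j ∎
      where
      P : Carrier
      P = sum λ v → Y v j * Y* (σ i) v

    vertexMatrix≋Z : ∀ i j → vertexMatrix m a b u Y Y* i j ≈ Z i j
    vertexMatrix≋Z i j = begin
      vertexMatrix m a b u Y Y* i j
        ≈⟨ scaledDifference-cong (reflexive (𝟙-sym j i)) (sum-cong-≋ λ k →
             trans (*-congʳ (sum-𝟙ˡ j (Y* (σ k)))) (*-comm (Y* (σ k) j) (Y i k))) ⟩
      scaledDifference (1# - a * b * u ^ 2) t (𝟙 i j) (sum G)
        ≈⟨ scaledDifference-expand a b u (𝟙 i j) (sum G) ⟩
      q * 𝟙 i j + - t * (sum G + u * b * 𝟙 i j)
        -- The identity entry is replaced by that of YS · SY*, so that both terms become sums over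
        -- arcs and merge into Y (𝟙 + bu S) X.
        ≈⟨ +-congˡ (*-congˡ (+-congˡ (*-congˡ (sum-YY* i j)))) ⟨
      q * 𝟙 i j + - t * (sum G + u * b * sum H)
        ≈⟨ +-congˡ (*-congˡ (+-congˡ (*-distribˡ-sum (u * b) H))) ⟩
      q * 𝟙 i j + - t * (sum G + sum (λ k → u * b * H k))
        ≈⟨ +-congˡ (*-congˡ (∑-distrib-+ G (λ k → u * b * H k))) ⟨
      q * 𝟙 i j + - t * sum (λ k → G k + u * b * H k)
        ≈⟨ +-congˡ (*-distribˡ-sum (- t) (λ k → G k + u * b * H k)) ⟩
      q * 𝟙 i j + sum (λ k → - t * (G k + u * b * H k))
        ≈⟨ +-congˡ (sum-cong-≋ λ k → solve 5 (λ t x s w y →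
             t :* (x :* s :+ w :* (y :* s)) := (x :+ w :* y) :* (t :* s))
             refl (- t) (Y i k) (Y* (σ k) j) (u * b) (Y i (σ k))) ⟩
      Z i j ∎
      where
      G H : Vector Carrier (m ℕ.+ m)
      G k = Y i k * Y* (σ k) j
      H k = Y i (σ k) * Y* (σ k) j

    det-arcMatrix : q ^ n * det (arcMatrix m a b u Y Y*) ≈ q ^ m * det (vertexMatrix m a b u Y Y*)
    det-arcMatrix = begin
      q ^ n * det (arcMatrix m a b u Y Y*)
        ≈⟨ *-congˡ (det-cong arcMatrix≋L) ⟩
      q ^ n * det L
        ≈⟨ det-sylvester m (-‿inverseˡ (u * b)) (det-base b u) Y X ⟩
      q ^ m * det Z
        ≈⟨ *-congˡ (det-cong vertexMatrix≋Z) ⟨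
      q ^ m * det (vertexMatrix m a b u Y Y*)  ∎

open import Defs
open import Data.Integer.Base using () renaming (_⊖_ to _⊖ℤ_)

-- Arc reversal in the enumeration of arcs

module _ {n} (G : SimpleGraph n) {m} (edges : Fin m ↔ Edge G) where

  open Inverse (arcs G edges) using (to)

  private
    split : Fin m ⊎ Fin m → Arc G
    split = orientations G ∘ Sum.map (Inverse.to edges) (Inverse.to edges)

  reverse-involutive : ∀ e → reverse G (reverse G e) ≡ e
  reverse-involutive _ = Arc-≡ G

  -- By definition arc m + i is the reverse of arc i; the converse half uses that reversal is an
  -- involution.
  to-swapHalves : ∀ i → to (swapHalves m i) ≡ reverse G (to i)
  to-swapHalves = ∀-+ m
    (λ i → ≡.trans (≡.cong to (swapHalves-↑ˡ m i))
      (≡.trans (≡.cong split (Fin.splitAt-↑ʳ m m i))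
        (≡.cong (reverse G ∘ split) (≡.sym (Fin.splitAt-↑ˡ m i m)))))
    (λ i → ≡.trans (≡.cong to (swapHalves-↑ʳ m i))
      (≡.trans (≡.cong split (Fin.splitAt-↑ˡ m i m))
        (≡.trans (≡.sym (reverse-involutive _))
          (≡.cong (reverse G ∘ split) (≡.sym (Fin.splitAt-↑ʳ m m i))))))

-- Integer powers and the zeta function

private
  module C = CommutativeRing ℂ-commutativeRing

open MatrixDeterminant ℂ-commutativeRing
open SemiringSum C.semiring

-- Common factors q are cancelled until one exponent is 0; there `m ⊖ℤ n` computes to a constructor
-- of ℤ, and the integer power to a power of q or of its inverse.
cancel-powers : ∀ {q} (q#0 : q # 0#) m n {x y} →
                q ^ n * x ≈ q ^ m * y → x ≈ q ^ᶻ m ⊖ℤ n ⟨ q#0 ⟩ * y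
cancel-powers q#0 m zero {x} h = C.trans (C.sym (C.*-identityˡ x)) h
cancel-powers {q} q#0 zero (suc n) {y = y} h =
  cancel-power (*-⁻¹ q q#0) (suc n) (C.trans h (C.*-identityˡ y))
cancel-powers {q} q#0 (suc m) (suc n) {x} {y} h =
  ≡.subst (λ k → x ≈ q ^ᶻ k ⟨ q#0 ⟩ * y) (≡.sym ([1+m]⊖[1+n]≡m⊖n m n))
    (cancel-powers q#0 m n (cancel-invertible (*-⁻¹ q q#0)
      (C.trans (C.sym (C.*-assoc q (q ^ n) x)) (C.trans h (C.*-assoc q (q ^ m) y)))))

⁻¹-involutive : ∀ z (z#0 : z # 0#) (w#0 : z ⁻¹⟨ z#0 ⟩ # 0#) → z ⁻¹⟨ z#0 ⟩ ⁻¹⟨ w#0 ⟩ ≈ z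
⁻¹-involutive z z#0 w#0 = cancel-invertible {q = w} w*z≈1
  (C.trans (*-⁻¹ w w#0) (C.sym w*z≈1))
  where
  w : ℂ
  w = z ⁻¹⟨ z#0 ⟩
  w*z≈1 : w * z ≈ 1#
  w*z≈1 = C.trans (C.*-comm w z) (*-⁻¹ z z#0)

det≈⇒zeta⁻¹≈ : ∀ {k} {X : Set} (X≃ : Fin k ↔ X) (U : ℓ² X → ℓ² X) u {z} →
  detOp X≃ (I ⊖ u • U) ≈ z →
  detOp X≃ (I ⊖ u • U) ≈ z × (∀ p → zeta X≃ U u p ⁻¹⟨ zeta-#0 X≃ U u p ⟩ ≈ z)
det≈⇒zeta⁻¹≈ X≃ U u det≈ = det≈ , λ p →
  C.trans (⁻¹-involutive (detOp X≃ (I ⊖ u • U)) p (zeta-#0 X≃ U u p)) det≈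

-- From operators to matrices

opaque
  unfolding walkForm scaledDifference

  -- The three values enter through equations, so that callers can put in the enumerated entries
  -- while `walkForm` stays folded.
  walk-apply : ∀ {n} (G : SimpleGraph n)
    (d : ℓ² (Arc G) → ℓ² (Fin n)) (d* : ℓ² (Fin n) → ℓ² (Arc G)) a b u f e {D E P} →
    f e ≡ D → f (reverse G e) ≡ E → d* (d f) (reverse G e) ≡ P →
    (I ⊖ u • (reversal G ∘ (a • (d* ∘ d) ⊕ b • (I ⊖ d* ∘ d)))) f e ≡ walkForm a b u D E P
  walk-apply G d d* a b u f e ≡.refl ≡.refl ≡.refl = ≡.refl

  scaledDifference-apply : ∀ {X} (T : ℓ² X → ℓ² X) x y f e {E} → T f e ≈ E →
                           (x • I ⊖ y • T) f e ≈ scaledDifference x y (f e) E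
  scaledDifference-apply T x y f e T≈E =
    C.+-congˡ {x * f e} {C.- (y * T f e)} (C.-‿cong {y * T f e} (C.*-congˡ {y} {T f e} T≈E))

-- The enumeration of the arcs and the adjoint are kept abstract, for the same reason of
-- feasibility as above; the codomain of d* is Arc G, unfolded as in the elaborated theorem, so
-- that the two statements agree syntactically.
module _ {n m} (G : SimpleGraph n) (R : Fin (m ℕ.+ m) ↔ Arc G)
         (to-swap : ∀ i → Inverse.to R (swapHalves m i) ≡ reverse G (Inverse.to R i))
         (d : ℓ² (Arc G) → ℓ² (Fin n))
         (d* : ℓ² (Fin n) → ℓ² (Σ (Fin n) λ u → Σ-syntax (Fin n) (SimpleGraph.Adj G u)))
         (d-expand : ∀ ω v → d ω v ≈ sum λ j → ω (Inverse.to R j) C.* d (δ R (Inverse.to R j)) v)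
         (d*-apply : ∀ f e → d* f e ≡ sum λ v → f v C.* conj (d (δ R e) v))
         (dd*≋I : d ∘ d* ≋ I) where

  open Inverse R using (to; strictlyInverseʳ)

  private
    σ : Fin (m ℕ.+ m) → Fin (m ℕ.+ m)
    σ = swapHalves m

    Y : Matrix n (m ℕ.+ m)
    Y v j = d (δ R (to j)) v

    Y* : Matrix (m ℕ.+ m) n
    Y* j v = conj (Y v j)

    δᵛ : Fin n → ℓ² (Fin n)
    δᵛ = δ (↔-id (Fin n))

    d*δ : ∀ v e → d* (δᵛ v) e ≡ sum λ w → 𝟙 v w C.* conj (d (δ R e) w)
    d*δ v = d*-apply (δᵛ v)

    -- The identity dd* = I at a basis vector, with d expanded over the arcs.
    YY*≈𝟙 : ∀ i j → sum (λ k → sum (λ v → 𝟙 j v C.* Y* k v) C.* Y i k) ≈ 𝟙 j i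
    YY*≈𝟙 i j = C.trans
      (C.sym (C.trans (d-expand (d* (δᵛ j)) i)
        (C.reflexive (sum-cong-≗ λ k → ≡.cong (C._* Y i k) (d*δ j (to k))))))
      (dd*≋I (δᵛ j) i)

    δ-to : ∀ i j → δ R (to j) (to i) ≡ 𝟙 j i
    δ-to i j = ≡.cong₂ 𝟙 (strictlyInverseʳ j) (strictlyInverseʳ i)

  module _ (a b u : ℂ) where

    arcMatrix-entry : ∀ i j →
      (I ⊖ u • (reversal G ∘ (a • (d* ∘ d) ⊕ b • (I ⊖ d* ∘ d)))) (δ R (to j)) (to i) ≡
      arcMatrix m a b u Y Y* i j
    arcMatrix-entry i j = walk-apply G d d* a b u (δ R (to j)) (to i)
      (δ-to i j)
      (≡.trans (≡.cong (δ R (to j)) (≡.sym (to-swap i))) (δ-to (σ i) j))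
      (≡.trans (≡.cong (d* (d (δ R (to j)))) (≡.sym (to-swap i)))
        (d*-apply (d (δ R (to j))) (to (σ i))))

    vertexMatrix-entry : ∀ i j →
      ((1# - a * b * u ^ 2) • I ⊖ ((a - b) * u) • (d ∘ reversal G ∘ d*)) (δᵛ j) i ≈
      vertexMatrix m a b u Y Y* i j
    vertexMatrix-entry i j = scaledDifference-apply (d ∘ reversal G ∘ d*)
      (1# - a * b * u ^ 2) ((a - b) * u) (δᵛ j) i
      (C.trans (d-expand (reversal G (d* (δᵛ j))) i)
        (C.reflexive (sum-cong-≗ λ k → ≡.cong (C._* Y i k)
          (≡.trans (≡.cong (d* (δᵛ j)) (≡.sym (to-swap k))) (d*δ j (to (σ k)))))))

    det-walk :
      let V = ↔-id (Fin n)
          S = reversal G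
          C = a • (d* ∘ d) ⊕ b • (I ⊖ d* ∘ d)
          U = S ∘ C
      in
      (b²u²≠1 : b ^ 2 * u ^ 2 # 1#) →
      let rhs = (1# - b ^ 2 * u ^ 2) ^ᶻ m ⊖ℤ n ⟨ #⇒-#0 b²u²≠1 ⟩
                * detOp V ((1# - a * b * u ^ 2) • I ⊖ ((a - b) * u) • (d ∘ S ∘ d*))
      in
      detOp R (I ⊖ u • U) ≈ rhs
      × (∀ (p : detOp R (I ⊖ u • U) # 0#) → zeta R U u p ⁻¹⟨ zeta-#0 R U u p ⟩ ≈ rhs)
    det-walk b²u²≠1 = det≈⇒zeta⁻¹≈ R (reversal G ∘ (a • (d* ∘ d) ⊕ b • (I ⊖ d* ∘ d))) u
      (cancel-powers (#⇒-#0 b²u²≠1) m n (begin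
        q ^ n * detOp R (I ⊖ u • (reversal G ∘ (a • (d* ∘ d) ⊕ b • (I ⊖ d* ∘ d))))
          ≈⟨ C.*-congˡ {q ^ n} (det-cong λ i j → C.reflexive (arcMatrix-entry i j)) ⟩
        q ^ n * det (arcMatrix m a b u Y Y*)
          ≈⟨ det-arcMatrix m a b u Y Y* YY*≈𝟙 ⟩
        q ^ m * det (vertexMatrix m a b u Y Y*)
          ≈⟨ C.*-congˡ {q ^ m} (det-cong vertexMatrix-entry) ⟨
        q ^ m * detOp (↔-id (Fin n))
          ((1# - a * b * u ^ 2) • I ⊖ ((a - b) * u) • (d ∘ reversal G ∘ d*)) ∎))
      where
      open SetoidReasoning C.setoid
      open Determinant ℂ-commutativeRing using (det)
      q : ℂ
      q = 1# - b ^ 2 * u ^ 2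

theorem5 : ∀ {n m : ℕ} (G : SimpleGraph n) (edges : Fin m ↔ Edge G) → Connected G →
    (a b : ℂ) (d : ℓ² (Arc G) → ℓ² (Fin n)) → IsLinear d →
    let V  = ↔-id (Fin n)
        R  = arcs G edges
        c  = a - b
        S  = reversal G
        d* = adjoint R V d
        C  = a • (d* ∘ d) ⊕ b • (I ⊖ d* ∘ d)
        U  = S ∘ C
    in
    d ∘ d* ≋ I →
    (u : ℂ) (b²u²≠1 : b ^ 2 * u ^ 2 # 1#) →
    let rhs = (1# - b ^ 2 * u ^ 2) ^ᶻ m ⊖ℤ n ⟨ #⇒-#0 b²u²≠1 ⟩
              * detOp V ((1# - a * b * u ^ 2) • I ⊖ (c * u) • (d ∘ S ∘ d*))
    in
    detOp R (I ⊖ u • U) ≈ rhs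
    × (∀ (p : detOp R (I ⊖ u • U) # 0#) → zeta R U u p ⁻¹⟨ zeta-#0 R U u p ⟩ ≈ rhs)
theorem5 {n} {m} G edges _ a b d linear dd*≋I u b²u²≠1 =
  -- Linearity of `d` enters through `expand`; the formula for the adjoint holds by definition.
  det-walk {n} {m} G (arcs G edges) (to-swapHalves G edges)
    d (adjoint (arcs G edges) (↔-id (Fin n)) d)
    (expand (arcs G edges) (↔-id (Fin n)) linear) (λ _ _ → ≡.refl) dd*≋I a b u b²u²≠1
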